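{- Let $k \geq 2$ be an integer and let $G$ be a $k$-connected graph of order $n$. If $\chi(G) \geq n - k$, then either $G$ is Hamiltonian, or $n \geq 2k + 1$ and $G$ is (isomorphic to) the graph $K_k \vee (K_k^c \cup K_{n-2k})$.
   Context: All graphs are finite and undirected, without loops or multiple edges. The order of a graph is its number of vertices. $\chi(G)$ denotes the chromatic number of $G$. $K_m$ denotes the complete graph on $m$ vertices, and $G^c$ denotes the complement of $G$ (so $K_k^c$ is the graph with $k$ vertices and no edges). $G \cup H$ denotes the disjoint union of two graphs with disjoint vertex sets, and $G \vee H$ denotes the join of two disjoint graphs $G$ and $H$, i.e. the graph obtained from their disjoint union by adding all edges between vertices of $G$ and vertices of $H$. A graph is $k$-connected if it has more than $k$ vertices and remains connected after deletion of any set of fewer than $k$ vertices. A graph is Hamiltonian if it has a Hamiltonian cycle, i.e. a cycle containing all of its vertices. -}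

module Defs where

open import Data.Fin using (Fin)
open import Data.Fin.Base using (finToFun; funToFin)
open import Data.Fin.Properties using (_≟_; all?; any?; finToFun-funToFin)
open import Data.Fin.Subset using (Subset; _∉_; ∣_∣)
open import Data.List using (List; _∷_; _++_; [_]; length)
open import Data.List.Membership.Propositional using (_∈_)
open import Data.List.Relation.Unary.Linked using (Linked)
open import Data.List.Relation.Unary.Unique.Propositional using (Unique)
open import Data.Nat using (ℕ; zero; suc; _≤_; _<_; _≥_; _>_; z≤n; s≤s)
open import Data.Product using (Σ; ∃; ∃₂; _×_; _,_; proj₁; proj₂)
open import Data.Sum using (_⊎_; inj₁; inj₂)
open import Data.Sum.Relation.Binary.Pointwise using (Pointwise; inj₁; inj₂; ⊎-symmetric; ⊎-decidable)
open import Data.Unit using (⊤; tt)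
open import Function using (id; _∘_)
open import Function.Bundles using (_↔_; _⇔_; Inverse)
open import Level using (0ℓ)
open import Relation.Binary.Construct.Closure.ReflexiveTransitive using (Star)
open import Relation.Binary.Core using (Rel)
open import Relation.Binary.Definitions using (Symmetric; Irreflexive; Decidable)
open import Relation.Binary.PropositionalEquality using (_≡_; _≢_; refl; sym; trans)
open import Relation.Nullary using (Dec; yes; no; ¬_; ¬?; contradiction)
open import Relation.Nullary.Decidable using (map′; _×-dec_; _→-dec_)

-- Finiteness is imposed by taking V = Fin n; a general V lets vertex deletion,
-- disjoint union and join use subtypes and sums as vertex sets.
record Graph (V : Set) : Set₁ where
  field
    Adj        : Rel V 0ℓ
    adj?       : Decidable Adj
    adj-sym    : Symmetric Adj
    adj-irrefl : Irreflexive _≡_ Adj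

open Graph public

private variable
  V W : Set
  n   : ℕ

K : ∀ m → Graph (Fin m)
K m .Adj x y            = x ≢ y
K m .adj? x y           = ¬? (x ≟ y)
K m .adj-sym x≢y        = x≢y ∘ sym
K m .adj-irrefl x≡y x≢y = x≢y x≡y

infix  9 _ᶜ
infixr 6 _∪_ _∨_

_ᶜ : Graph (Fin n) → Graph (Fin n)
(G ᶜ) .Adj x y                    = x ≢ y × ¬ Adj G x y
(G ᶜ) .adj? x y                   = ¬? (x ≟ y) ×-dec ¬? (adj? G x y)
(G ᶜ) .adj-sym (x≢y , ¬xy)        = x≢y ∘ sym , ¬xy ∘ adj-sym G
(G ᶜ) .adj-irrefl x≡y (x≢y , _)   = x≢y x≡y

_∪_ : Graph V → Graph W → Graph (V ⊎ W)
(G ∪ H) .Adj                        = Pointwise (Adj G) (Adj H)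
(G ∪ H) .adj?                       = ⊎-decidable (adj? G) (adj? H)
(G ∪ H) .adj-sym                    = ⊎-symmetric (adj-sym G) (adj-sym H)
(G ∪ H) .adj-irrefl refl (inj₁ e)   = adj-irrefl G refl e
(G ∪ H) .adj-irrefl refl (inj₂ e)   = adj-irrefl H refl e

_∨_ : Graph V → Graph W → Graph (V ⊎ W)
(G ∨ H) .Adj (inj₁ x) (inj₁ y)               = Adj G x y
(G ∨ H) .Adj (inj₁ _) (inj₂ _)               = ⊤
(G ∨ H) .Adj (inj₂ _) (inj₁ _)               = ⊤
(G ∨ H) .Adj (inj₂ x) (inj₂ y)               = Adj H x y
(G ∨ H) .adj? (inj₁ x) (inj₁ y)              = adj? G x y
(G ∨ H) .adj? (inj₁ _) (inj₂ _)              = yes tt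
(G ∨ H) .adj? (inj₂ _) (inj₁ _)              = yes tt
(G ∨ H) .adj? (inj₂ x) (inj₂ y)              = adj? H x y
(G ∨ H) .adj-sym {inj₁ _} {inj₁ _} e         = adj-sym G e
(G ∨ H) .adj-sym {inj₁ _} {inj₂ _} _         = tt
(G ∨ H) .adj-sym {inj₂ _} {inj₁ _} _         = tt
(G ∨ H) .adj-sym {inj₂ _} {inj₂ _} e         = adj-sym H e
(G ∨ H) .adj-irrefl {inj₁ _} refl e          = adj-irrefl G refl e
(G ∨ H) .adj-irrefl {inj₂ _} refl e          = adj-irrefl H refl e

infix 4 _≅_

_≅_ : Graph V → Graph W → Set
_≅_ {V} {W} G H = Σ (V ↔ W) λ f →
  ∀ x y → Adj G x y ⇔ Adj H (Inverse.to f x) (Inverse.to f y)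

-- Any two proofs of v ∉ S are definitionally equal, so no vertex is duplicated.
infixl 7 _−_

_−_ : Graph (Fin n) → (S : Subset n) → Graph (∃ λ v → v ∉ S)
(G − S) .Adj (x , _) (y , _)  = Adj G x y
(G − S) .adj? (x , _) (y , _) = adj? G x y
(G − S) .adj-sym              = adj-sym G
(G − S) .adj-irrefl refl      = adj-irrefl G refl

Connected : Graph V → Set
Connected G = ∀ u v → Star (Adj G) u v

infix 4 _-Connected_

_-Connected_ : ℕ → Graph (Fin n) → Set
_-Connected_ {n} k G = n > k × (∀ (S : Subset n) → ∣ S ∣ < k → Connected (G − S))

-- The cycle runs through v, then the vertices of vs in order, and back to v.
record IsCycle (G : Graph V) (v : V) (vs : List V) : Set where
  field
    length≥3 : length (v ∷ vs) ≥ 3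
    distinct : Unique (v ∷ vs)
    adjacent : Linked (Adj G) (v ∷ vs ++ [ v ])

Hamiltonian : Graph V → Set
Hamiltonian G = ∃₂ λ v vs → IsCycle G v vs × (∀ u → u ∈ v ∷ vs)

IsProper : (G : Graph V) {m : ℕ} → (V → Fin m) → Set
IsProper G c = ∀ x y → Adj G x y → c x ≢ c y

Colorable : Graph V → ℕ → Set
Colorable {V} G m = Σ (V → Fin m) (IsProper G)

colorable? : (G : Graph (Fin n)) → ∀ m → Dec (Colorable G m)
colorable? G m = map′
  (λ (i , p) → finToFun i , p)
  (λ (c , p) → funToFin c , λ x y e eq → p x y e
    (trans (sym (finToFun-funToFin c x)) (trans eq (finToFun-funToFin c y))))
  (any? λ i → all? λ x → all? λ y →
    adj? G x y →-dec ¬? (finToFun {m} i x ≟ finToFun i y))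

IsLeast : (ℕ → Set) → ℕ → Set
IsLeast P l = P l × (∀ m → P m → l ≤ m)

least : {P : ℕ → Set} → (∀ m → Dec (P m)) → ∀ m → P m → ∃ (IsLeast P)
least P? zero    p = zero , p , λ _ _ → z≤n
least P? (suc m) p with P? zero
... | yes p₀ = zero , p₀ , λ _ _ → z≤n
... | no ¬p₀ with least (P? ∘ suc) m p
...   | l , pₗ , l≤ = suc l , pₗ , λ where
          zero    p₀ → contradiction p₀ ¬p₀
          (suc j) pⱼ → s≤s (l≤ j pⱼ)

chromaticNumber : (G : Graph (Fin n)) → ∃ (IsLeast (Colorable G))
chromaticNumber {n} G =
  least (colorable? G) n (id , λ _ _ e x≡y → adj-irrefl G x≡y e)

χ : Graph (Fin n) → ℕ
χ G = proj₁ (chromaticNumber G)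

{-# OPTIONS --safe #-}
module Submission where

-- Starting from an edge, a circuit Z is enlarged as long as possible. If h lies
-- outside Z, deleting fewer than k vertices of Z does not separate h from Z, so
-- k vertices of Z are reached from h by paths avoiding Z. Unless two of these
-- paths allow Z to be enlarged, the successors of their ends on Z form with h an
-- independent set of k + 1 vertices (Chvátal–Erdős). Since χ(G) ≥ n − k, the
-- vertices outside that set form a clique, which some vertex of the set extends.
-- So V is a clique C with more than k vertices and an independent set I of k
-- vertices, each with at least k neighbours, all in C. The vertices of I are
-- inserted one by one into a circuit through C by the same rerouting. When i
-- cannot be inserted, all other vertices of I are on the circuit between
-- neighbours of i; exchanging i with another vertex j of I and trying to insert j
-- shows that j has the same k neighbours as i.

open import Data.Bool using (true; false)
open import Data.Fin using (Fin; zero; suc)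
open import Data.Fin.Properties using (_≟_; all?; ¬∀⟶∃¬)
open import Data.Fin.Subset using (Subset; ⁅_⁆; ∣_∣; ⊥) renaming (_∪_ to _∪ₛ_; _∈_ to _∈ₛ_)
open import Data.Fin.Subset.Properties
  using (x∈p∪q⁻; x∈p∪q⁺; ∣⁅x⁆∣≡1; ∣⊥∣≡0; ∉⊥; x∈⁅x⁆; x∈⁅y⁆⇒x≡y)
open import Data.List using (List; []; _∷_; _++_; [_]; length; lookup; map; reverse; filter; allFin)
import Data.List.Membership.DecPropositional as DecPropositional
open import Data.List.Membership.Propositional using (_∈_; _∉_; lose; find)
open import Data.List.Membership.Propositional.Properties
  using ( ∈-map⁺; ∈-map⁻; ∈-++⁺ˡ; ∈-++⁺ʳ; ∈-++⁻; ∈-insert; ∈-∃++; ∈-filter⁺; ∈-filter⁻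
        ; ∈-lookup; ∈-allFin)
open import Data.List.Membership.Setoid.Properties using (index-injective)
open import Data.List.Properties
  using ( ++-assoc; ++-identityʳ; length-++; length-map; length-tabulate; filter-notAll
        ; map-++; unfold-reverse; reverse-++; reverse-involutive)
open import Data.List.Relation.Binary.Permutation.Propositional
  using (_↭_; module PermutationReasoning; ↭-refl; ↭-sym; ↭-trans; prep; ↭-reflexive; ↭⇒↭ₛ)
open import Data.List.Relation.Binary.Permutation.Propositional.Properties
  using (∈-resp-↭; ↭-length; ↭-reverse; ++⁺ˡ; ++⁺ʳ; shift)
  renaming (++-comm to ↭-++-comm)
import Data.List.Relation.Binary.Permutation.Setoid.Properties as PermutationSetoid
open import Data.List.Relation.Unary.All as All using ([]; _∷_)
open import Data.List.Relation.Unary.All.Properties using (¬Any⇒All¬; ¬All⇒Any¬)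
open import Data.List.Relation.Unary.AllPairs as AllPairs using ([]; _∷_)
open import Data.List.Relation.Unary.Any as Any using (here; there)
open import Data.List.Relation.Unary.Any.Properties using (lookup-index)
open import Data.List.Relation.Unary.Linked using (Linked; []; [-]; _∷_)
open import Data.List.Relation.Unary.Unique.Propositional using (Unique)
open import Data.List.Relation.Unary.Unique.Propositional.Properties
  using (Unique[x∷xs]⇒x∉xs; allFin⁺) renaming (++⁺ to Unique-++⁺; filter⁺ to Unique-filter⁺)
open import Data.Nat using (ℕ; zero; suc; _+_; _*_; _∸_; _≤_; _<_; _≥_; _>_; z≤n; s≤s)
import Data.Nat.Properties as ℕ
open import Data.Product using (∃; ∃₂; _×_; _,_; proj₁; proj₂)
open import Data.Sum using (_⊎_; inj₁; inj₂; [_,_]′; map₂)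
import Data.Sum.Relation.Binary.Pointwise as Pointwise
open import Data.Vec using ([]; _∷_)
open import Function using (_∘_; id)
open import Function.Bundles using (_↔_; _⇔_; mk↔ₛ′; mk⇔; Equivalence)
open import Relation.Binary.Construct.Closure.ReflexiveTransitive as Star using (Star; ε; _◅_; _◅◅_)
open import Relation.Binary.PropositionalEquality
  using (_≡_; _≢_; refl; sym; trans; cong; cong₂; subst; subst₂; setoid; module ≡-Reasoning)
open import Relation.Nullary using (yes; no; ¬_; ¬?; contradiction)
open import Defs

private variable
  A B : Set
  n : ℕ

-- Lists without repetition

Unique-∷ : {x : A} {xs : List A} → x ∉ xs → Unique xs → Unique (x ∷ xs)
Unique-∷ x∉ u = ¬Any⇒All¬ _ x∉ ∷ u

Unique-resp-↭ : {xs ys : List A} → xs ↭ ys → Unique xs → Unique ys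
Unique-resp-↭ {A} p = PermutationSetoid.Unique-resp-↭ (setoid A) (↭⇒↭ₛ p)

Unique-map-injective : (f : A → B) {xs : List A} → Unique (map f xs) →
  ∀ {x y} → x ∈ xs → y ∈ xs → f x ≡ f y → x ≡ y
Unique-map-injective f          u       (here refl) (here refl) e = refl
Unique-map-injective f {_ ∷ xs} u       (here refl) (there q)   e =
  contradiction (subst (_∈ map f xs) (sym e) (∈-map⁺ f q)) (Unique[x∷xs]⇒x∉xs u)
Unique-map-injective f {_ ∷ xs} u       (there p)   (here refl) e =
  contradiction (subst (_∈ map f xs) e (∈-map⁺ f p)) (Unique[x∷xs]⇒x∉xs u)
Unique-map-injective f          (_ ∷ u) (there p)   (there q)   e = Unique-map-injective f u p q e

-- The pigeonhole principle behind the counting arguments: erasing the head of `xs` from `ys` loses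
-- at least one entry and keeps the rest of `xs`.
length-⊆ : {xs ys : List (Fin n)} → Unique xs → (∀ {v} → v ∈ xs → v ∈ ys) → length xs ≤ length ys
length-⊆ {xs = []}     u       sub = z≤n
length-⊆ {xs = x ∷ xs} {ys} u@(_ ∷ u′) sub = ℕ.≤-<-trans
  (length-⊆ u′ λ v∈ → ∈-filter⁺ (λ y → ¬? (y ≟ x)) (sub (there v∈))
    λ { refl → Unique[x∷xs]⇒x∉xs u v∈ })
  (filter-notAll (λ y → ¬? (y ≟ x)) ys (lose (sub (here refl)) λ y≢ → y≢ refl))

Unique-map-on⁺ : (f : A → B) (xs : List A) → (∀ {x y} → x ∈ xs → y ∈ xs → f x ≡ f y → x ≡ y) →
  Unique xs → Unique (map f xs)
Unique-map-on⁺ f []       inj _       = []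
Unique-map-on⁺ f (x ∷ xs) inj u@(_ ∷ u′) = Unique-∷ fx∉ (Unique-map-on⁺ f xs (λ p q → inj (there p) (there q)) u′)
  where
  fx∉ : f x ∉ map f xs
  fx∉ p with ∈-map⁻ f p
  ... | y , y∈ , e = Unique[x∷xs]⇒x∉xs u (subst (_∈ xs) (sym (inj (here refl) (there y∈) e)) y∈)

lookup-injective : {xs : List A} → Unique xs → ∀ i j → lookup xs i ≡ lookup xs j → i ≡ j
lookup-injective {xs = _ ∷ _}  u zero zero e = refl
lookup-injective {xs = _ ∷ xs} u zero (suc j) e =
  contradiction (subst (_∈ xs) (sym e) (∈-lookup j)) (Unique[x∷xs]⇒x∉xs u)
lookup-injective {xs = _ ∷ xs} u (suc i) zero e =
  contradiction (subst (_∈ xs) e (∈-lookup i)) (Unique[x∷xs]⇒x∉xs u)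
lookup-injective {xs = _ ∷ _}  (_ ∷ u) (suc i) (suc j) e = cong suc (lookup-injective u i j e)

-- Consecutive pairs

steps : List A → List (A × A)
steps []           = []
steps (x ∷ [])     = []
steps (x ∷ y ∷ zs) = (x , y) ∷ steps (y ∷ zs)

steps-++ : ∀ (xs : List A) y ys → steps (xs ++ y ∷ ys) ≡ steps (xs ++ [ y ]) ++ steps (y ∷ ys)
steps-++ []            y ys = refl
steps-++ (x ∷ [])      y ys = refl
steps-++ (x ∷ x′ ∷ xs) y ys = cong ((x , x′) ∷_) (steps-++ (x′ ∷ xs) y ys)

steps-reverse : ∀ (xs : List A) {x y} → (x , y) ∈ steps xs → (y , x) ∈ steps (reverse xs)
steps-reverse (a ∷ b ∷ xs) p
  rewrite unfold-reverse a (b ∷ xs) | unfold-reverse b xs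
        | ++-assoc (reverse xs) [ b ] [ a ] | steps-++ (reverse xs) b [ a ] with p
... | here refl = ∈-++⁺ʳ (steps (reverse xs ++ [ b ])) (here refl)
... | there q   = ∈-++⁺ˡ (subst (λ l → _ ∈ steps l) (unfold-reverse b xs) (steps-reverse (b ∷ xs) q))

steps-map : (f : A → B) (xs : List A) {x y : B} → (x , y) ∈ steps (map f xs) →
  ∃₂ λ a b → (a , b) ∈ steps xs × x ≡ f a × y ≡ f b
steps-map f (a ∷ b ∷ xs) (here refl) = a , b , here refl , refl , refl
steps-map f (a ∷ b ∷ xs) (there p) with steps-map f (b ∷ xs) p
... | c , d , q , e , e′ = c , d , there q , e , e′

map-proj₁-steps : ∀ (xs : List A) z → map proj₁ (steps (xs ++ [ z ])) ≡ xs
map-proj₁-steps []           z = refl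
map-proj₁-steps (x ∷ [])     z = refl
map-proj₁-steps (x ∷ y ∷ xs) z = cong (x ∷_) (map-proj₁-steps (y ∷ xs) z)

map-proj₂-steps : ∀ (x : A) xs → map proj₂ (steps (x ∷ xs)) ≡ xs
map-proj₂-steps x []       = refl
map-proj₂-steps x (y ∷ xs) = cong (y ∷_) (map-proj₂-steps y xs)

steps-closed : {P : A → Set} (xs : List A) (x : A) →
  (∀ {u v} → (u , v) ∈ steps (x ∷ xs) → P u → P v) → P x → ∀ {v} → v ∈ x ∷ xs → P v
steps-closed xs       x cl px (here refl) = px
steps-closed (y ∷ xs) x cl px (there v∈)  =
  steps-closed xs y (cl ∘ there) (cl (here refl) px) v∈

steps-irrefl : ∀ (xs : List A) z → Unique xs → z ∉ xs → ∀ {x} → (x , x) ∉ steps (xs ++ [ z ])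
steps-irrefl (y ∷ [])      z u z∉ (here refl) = z∉ (here refl)
steps-irrefl (y ∷ y′ ∷ xs) z u z∉ (here refl) = Unique[x∷xs]⇒x∉xs u (here refl)
steps-irrefl (y ∷ y′ ∷ xs) z (_ ∷ u) z∉ (there p) = steps-irrefl (y′ ∷ xs) z u (z∉ ∘ there) p

-- Cyclic successors

-- The head is repeated at the end to close the cycle, so a one-element list has the loop `(z , z)`
-- as its only edge.
edges : List A → List (A × A)
edges []       = []
edges (z ∷ zs) = steps (z ∷ zs ++ [ z ])

Next : List A → A → A → Set
Next zs x y = (x , y) ∈ edges zs

-- Keeping the head in place makes the closed walk `z ∷ zs ++ [ z ]` of the result the exact
-- reversal of the old one.
reverseCycle : List A → List A
reverseCycle []       = []
reverseCycle (z ∷ zs) = z ∷ reverse zs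

reverseCycle-↭ : (zs : List A) → reverseCycle zs ↭ zs
reverseCycle-↭ []       = ↭-refl
reverseCycle-↭ (z ∷ zs) = prep z (↭-reverse zs)

next-reverse : (zs : List A) {x y : A} → Next zs x y → Next (reverseCycle zs) y x
next-reverse (z ∷ zs) p = subst (λ l → _ ∈ steps l)
  (trans (unfold-reverse z (zs ++ [ z ])) (cong (_++ [ z ]) (reverse-++ zs [ z ])))
  (steps-reverse (z ∷ zs ++ [ z ]) p)

reverseCycle-involutive : (zs : List A) → reverseCycle (reverseCycle zs) ≡ zs
reverseCycle-involutive []       = refl
reverseCycle-involutive (z ∷ zs) = cong (z ∷_) (reverse-involutive zs)

next-reverse⁻ : (zs : List A) {x y : A} → Next (reverseCycle zs) x y → Next zs y x
next-reverse⁻ zs {x} {y} p = subst (λ l → Next l y x) (reverseCycle-involutive zs) (next-reverse (reverseCycle zs) p)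

next-total : (zs : List A) {x : A} → x ∈ zs → ∃ λ y → Next zs x y
next-total (z ∷ zs) x∈ with ∈-map⁻ proj₁ (subst (_ ∈_) (sym (map-proj₁-steps (z ∷ zs) z)) x∈)
... | (_ , y) , p , refl = y , p

next-source : (zs : List A) {x y : A} → Next zs x y → x ∈ zs
next-source (z ∷ zs) p = subst (_ ∈_) (map-proj₁-steps (z ∷ zs) z) (∈-map⁺ proj₁ p)

next-target : (zs : List A) {x y : A} → Next zs x y → y ∈ zs
next-target (z ∷ zs) p =
  ∈-resp-↭ (↭-++-comm zs [ z ]) (subst (_ ∈_) (map-proj₂-steps z (zs ++ [ z ])) (∈-map⁺ proj₂ p))

next-functional : (zs : List A) → Unique zs → ∀ {x y y′} → Next zs x y → Next zs x y′ → y ≡ y′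
next-functional (z ∷ zs) u p q = cong proj₂
  (Unique-map-injective proj₁ (subst Unique (sym (map-proj₁-steps (z ∷ zs) z)) u) p q refl)

-- Without its head the closed walk is `zs ++ [ z ]`, a rotation of the list, so the targets of the
-- edges are distinct like the sources.
next-injective : (zs : List A) → Unique zs → ∀ {x x′ y} → Next zs x y → Next zs x′ y → x ≡ x′
next-injective (z ∷ zs) u p q = cong proj₁
  (Unique-map-injective proj₂ (subst Unique (sym (map-proj₂-steps z (zs ++ [ z ])))
    (Unique-resp-↭ (↭-++-comm [ z ] zs) u)) p q refl)

next-irrefl : (zs : List A) → Unique zs → length zs ≥ 2 → ∀ {x} → ¬ Next zs x x
next-irrefl (z ∷ z′ ∷ zs) u _ (here refl) = Unique[x∷xs]⇒x∉xs u (here refl)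
next-irrefl (z ∷ z′ ∷ zs) u@(_ ∷ u′) _ (there p) =
  steps-irrefl (z′ ∷ zs) z u′ (Unique[x∷xs]⇒x∉xs u) p
next-irrefl (z ∷ []) u (s≤s ()) p

next-map : (f : A → B) (zs : List A) {x y : B} → Next (map f zs) x y →
  ∃₂ λ a b → Next zs a b × x ≡ f a × y ≡ f b
next-map f (z ∷ zs) p =
  steps-map f (z ∷ zs ++ [ z ]) (subst (λ l → _ ∈ steps (f z ∷ l)) (sym (map-++ f zs [ z ])) p)

-- Both closed walks consist of the arc from `a` to `x` and the arc from `x` back to `a`; only the
-- order of the two arcs differs.
edges-rotate : ∀ (as : List A) x bs → edges (as ++ x ∷ bs) ↭ edges (x ∷ bs ++ as)
edges-rotate []       x bs = ↭-reflexive (cong (λ l → edges (x ∷ l)) (sym (++-identityʳ bs)))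
edges-rotate (a ∷ as) x bs = begin
  steps (a ∷ (as ++ x ∷ bs) ++ [ a ])               ≡⟨ cong (λ l → steps (a ∷ l)) (++-assoc as (x ∷ bs) [ a ]) ⟩
  steps (a ∷ as ++ x ∷ (bs ++ [ a ]))               ≡⟨ steps-++ (a ∷ as) x (bs ++ [ a ]) ⟩
  steps (a ∷ as ++ [ x ]) ++ steps (x ∷ bs ++ [ a ]) ↭⟨ ↭-++-comm (steps (a ∷ as ++ [ x ])) _ ⟩
  steps (x ∷ bs ++ [ a ]) ++ steps (a ∷ as ++ [ x ]) ≡⟨ steps-++ (x ∷ bs) a (as ++ [ x ]) ⟨
  steps (x ∷ bs ++ a ∷ (as ++ [ x ]))               ≡⟨ cong (λ l → steps (x ∷ l)) (++-assoc bs (a ∷ as) [ x ]) ⟨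
  steps (x ∷ (bs ++ a ∷ as) ++ [ x ])               ∎
  where open PermutationReasoning

rotateTo : {zs : List A} {x : A} → x ∈ zs → ∃ λ ws → zs ↭ x ∷ ws × edges zs ↭ edges (x ∷ ws)
rotateTo {zs = zs} {x} x∈ with ∈-∃++ x∈
... | as , bs , refl = bs ++ as , ↭-++-comm as (x ∷ bs) , edges-rotate as x bs

next-closed : {P : A → Set} (zs : List A) → (∀ {u v} → Next zs u v → P u → P v) →
  ∀ {x} → x ∈ zs → P x → ∀ {v} → v ∈ zs → P v
next-closed {P = P} zs cl x∈ px v∈ with rotateTo x∈
... | ws , perm , eperm = steps-closed {P = P} (ws ++ [ _ ]) _ (cl ∘ ∈-resp-↭ (↭-sym eperm)) px
  (∈-++⁺ˡ (∈-resp-↭ perm v∈))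

successors : (zs : List A) → Unique zs → (T : List A) → Unique T → (∀ {t} → t ∈ T → t ∈ zs) →
  ∃ λ X → length X ≡ length T × Unique X × (∀ {x} → x ∈ X → ∃ λ t → t ∈ T × Next zs t x)
successors zs u []      _  _   = [] , refl , [] , λ ()
successors zs u (t ∷ T) uT@(_ ∷ uT′) sub
  with successors zs u T uT′ (sub ∘ there) | next-total zs (sub (here refl))
... | X , len , uX , back | x , p = x ∷ X , cong suc len , Unique-∷ x∉X uX , back′
  where
  x∉X : x ∉ X
  x∉X x∈ with back x∈
  ... | t′ , t′∈ , q = Unique[x∷xs]⇒x∉xs uT (subst (_∈ T) (next-injective zs u q p) t′∈)
  back′ : ∀ {y} → y ∈ x ∷ X → ∃ λ t′ → t′ ∈ t ∷ T × Next zs t′ y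
  back′ (here refl) = t , here refl , p
  back′ (there y∈) with back y∈
  ... | t′ , t′∈ , q = t′ , there t′∈ , q

-- Used to try an improvement at every entry: either one attempt yields the global result `R`, or
-- all the local obstructions `P` hold together.
sequence : {R : Set} {P : A → Set} (xs : List A) → (∀ {x} → x ∈ xs → R ⊎ P x) →
  R ⊎ (∀ {x} → x ∈ xs → P x)
sequence []       f = inj₂ λ ()
sequence (x ∷ xs) f with f (here refl) | sequence xs (f ∘ there)
... | inj₁ r  | _       = inj₁ r
... | inj₂ _  | inj₁ r  = inj₁ r
... | inj₂ px | inj₂ ps = inj₂ λ { (here refl) → px ; (there x∈) → ps x∈ }

-- Circuits and their rerouting

module Circuits {n} (G : Graph (Fin n)) where

  private V = Fin n

  Adjs : List V → Set
  Adjs xs = ∀ {x y} → (x , y) ∈ steps xs → Adj G x y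

  Adjs-join : ∀ as x bs → Adjs (as ++ [ x ]) → Adjs (x ∷ bs) → Adjs (as ++ x ∷ bs)
  Adjs-join as x bs f g p rewrite steps-++ as x bs = [ f , g ]′ (∈-++⁻ (steps (as ++ [ x ])) p)

  Adjs-prefix : ∀ as x bs → Adjs (as ++ x ∷ bs) → Adjs (as ++ [ x ])
  Adjs-prefix as x bs f p = f (subst (_ ∈_) (sym (steps-++ as x bs)) (∈-++⁺ˡ p))

  Adjs-suffix : ∀ as x bs → Adjs (as ++ x ∷ bs) → Adjs (x ∷ bs)
  Adjs-suffix as x bs f p = f (subst (_ ∈_) (sym (steps-++ as x bs)) (∈-++⁺ʳ (steps (as ++ [ x ])) p))

  Adjs-reverse : ∀ xs → Adjs xs → Adjs (reverse xs)
  Adjs-reverse xs f p = adj-sym G (f (subst (λ l → _ ∈ steps l) (reverse-involutive xs)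
    (steps-reverse (reverse xs) p)))

  Adjs-∷ : ∀ {x y} xs → Adj G x y → Adjs (y ∷ xs) → Adjs (x ∷ y ∷ xs)
  Adjs-∷ xs e f (here refl) = e
  Adjs-∷ xs e f (there p)   = f p

  -- Unlike in IsCycle, a single edge traversed back and forth counts.
  record Circuit (Z : List V) : Set where
    field
      unique  : Unique Z
      length≥2 : length Z ≥ 2
      adj     : ∀ {x y} → Next Z x y → Adj G x y

  open Circuit public

  Circuit-reverse : ∀ {Z} → Circuit Z → Circuit (reverseCycle Z)
  Circuit-reverse {Z} c .unique = Unique-resp-↭ (↭-sym (reverseCycle-↭ Z)) (unique c)
  Circuit-reverse {Z} c .length≥2 = subst (_≥ 2) (↭-length (↭-sym (reverseCycle-↭ Z))) (length≥2 c)
  Circuit-reverse {Z} c .adj = adj-sym G ∘ adj c ∘ next-reverse⁻ Z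

  -- Only vertices have to survive; the edges of `Z` may be rerouted.
  Extension : List V → List V → Set
  Extension Z P = ∃ λ Z′ → Circuit Z′ × (∀ {v} → v ∈ Z → v ∈ Z′) × (∀ {v} → v ∈ P → v ∈ Z′)

  extend : ∀ {Z P Z′} → Circuit Z → Unique P → (∀ {v} → v ∈ P → v ∉ Z) → Z′ ↭ P ++ Z →
    (∀ {x y} → Next Z′ x y → Adj G x y) → Extension Z P
  extend {Z} {P} {Z′} c uP P∉ perm adj′ = Z′ , record
    { unique   = Unique-resp-↭ (↭-sym perm) (Unique-++⁺ uP (unique c) λ (p , q) → P∉ p q)
    ; length≥2 = ℕ.≤-trans (length≥2 c) (ℕ.≤-trans (ℕ.m≤n+m _ (length P))
        (ℕ.≤-reflexive (trans (sym (length-++ P)) (↭-length (↭-sym perm)))))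
    ; adj      = adj′
    } , (∈-resp-↭ (↭-sym perm) ∘ ∈-++⁺ʳ P) , (∈-resp-↭ (↭-sym perm) ∘ ∈-++⁺ˡ)

  uncons-∷ʳ : ∀ (xs : List V) x → ∃₂ λ w ws → xs ++ [ x ] ≡ w ∷ ws
  uncons-∷ʳ []       x = x , [] , refl
  uncons-∷ʳ (w ∷ ws) x = w , ws ++ [ x ] , refl

  -- The two ways of rerouting along a path from `t₁` to `t₂` fail: `t₂` does not directly follow
  -- `t₁`, and the successors are not joined by a chord.
  Uncrossed : List V → V → V → Set
  Uncrossed Z t₁ t₂ = ∀ x y → Next Z t₁ x → Next Z t₂ y → x ≢ t₂ × ¬ Adj G x y

  -- The cycle t₁ b t₂ d is rerouted along P as t₁ P t₂ b⁻¹ d, using the chord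
  -- between the successors of t₁ and t₂.
  cross : ∀ {Z t₁ t₂} → Circuit Z → t₁ ∈ Z → t₂ ∈ Z → t₁ ≢ t₂ →
    ∀ P → Unique P → (∀ {v} → v ∈ P → v ∉ Z) → Adjs (t₁ ∷ P ++ [ t₂ ]) →
    Extension Z P ⊎ Uncrossed Z t₁ t₂
  cross {Z} {t₁} {t₂} c t₁∈ t₂∈ t₁≢t₂ P uP P∉ adjP with rotateTo t₁∈
  ... | ws , perm , eperm with Any.toSum (∈-resp-↭ perm t₂∈)
  ...   | inj₁ t₂≡t₁ = contradiction (sym t₂≡t₁) t₁≢t₂
  ...   | inj₂ t₂∈ws with ∈-∃++ t₂∈ws
  ...     | b , d , refl = go b perm edge
    where
    edge : ∀ {x y} → (x , y) ∈ steps ((t₁ ∷ b) ++ t₂ ∷ (d ++ [ t₁ ])) → Next Z x y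
    edge p = ∈-resp-↭ (↭-sym eperm)
      (subst (λ l → _ ∈ steps (t₁ ∷ l)) (sym (++-assoc b (t₂ ∷ d) [ t₁ ])) p)

    closeUp : ∀ ds → Adjs (t₂ ∷ ds ++ [ t₁ ]) → ∀ {x y} → Next (t₁ ∷ P ++ t₂ ∷ ds) x y → Adj G x y
    closeUp ds f p = Adjs-join (t₁ ∷ P) t₂ (ds ++ [ t₁ ]) adjP f
      (subst (λ l → _ ∈ steps (t₁ ∷ l)) (++-assoc P (t₂ ∷ ds) [ t₁ ]) p)

    go : ∀ b → Z ↭ t₁ ∷ b ++ t₂ ∷ d →
      (∀ {x y} → (x , y) ∈ steps ((t₁ ∷ b) ++ t₂ ∷ (d ++ [ t₁ ])) → Next Z x y) →
      Extension Z P ⊎ Uncrossed Z t₁ t₂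
    -- Here `t₂` directly follows `t₁`, and the path simply replaces that edge.
    go [] perm edge = inj₁ (extend c uP P∉
      (↭-trans (↭-sym (shift t₁ P (t₂ ∷ d))) (++⁺ˡ P (↭-sym perm)))
      (closeUp d (adj c ∘ edge ∘ there)))
    -- The successor `y₀` of `t₂` is the head of `d`, or `t₁` itself when `d` is empty; splitting
    -- `d ++ [ t₁ ]` treats both cases at once.
    go (x₀ ∷ b) perm edge with uncons-∷ʳ d t₁
    ... | y₀ , ys , eq with adj? G x₀ y₀
    ...   | yes x₀~y₀ = inj₁ (extend c uP P∉ permZ′ (closeUp (reverse (x₀ ∷ b) ++ d) adjs))
      where
      permZ′ : t₁ ∷ P ++ t₂ ∷ (reverse (x₀ ∷ b) ++ d) ↭ P ++ Z
      permZ′ = begin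
        t₁ ∷ P ++ t₂ ∷ (reverse (x₀ ∷ b) ++ d)   ↭⟨ shift t₁ P _ ⟨
        P ++ t₁ ∷ t₂ ∷ (reverse (x₀ ∷ b) ++ d)   ↭⟨ ++⁺ˡ P (prep t₁ (prep t₂ (++⁺ʳ d (↭-reverse (x₀ ∷ b))))) ⟩
        P ++ t₁ ∷ t₂ ∷ ((x₀ ∷ b) ++ d)           ↭⟨ ++⁺ˡ P (prep t₁ (shift t₂ (x₀ ∷ b) d)) ⟨
        P ++ t₁ ∷ (x₀ ∷ b) ++ t₂ ∷ d             ↭⟨ ++⁺ˡ P perm ⟨
        P ++ Z                                   ∎
        where open PermutationReasoning
      backward : Adjs (t₂ ∷ reverse b ++ [ x₀ ])
      backward = subst Adjs (trans (reverse-++ (x₀ ∷ b) [ t₂ ]) (cong (t₂ ∷_) (unfold-reverse x₀ b)))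
        (Adjs-reverse ((x₀ ∷ b) ++ [ t₂ ]) (Adjs-prefix (x₀ ∷ b) t₂ (d ++ [ t₁ ]) (adj c ∘ edge ∘ there)))
      forward : Adjs (x₀ ∷ d ++ [ t₁ ])
      forward = subst (λ l → Adjs (x₀ ∷ l)) (sym eq) (Adjs-∷ ys x₀~y₀
        (Adjs-suffix [ t₂ ] y₀ ys (subst (λ l → Adjs (t₂ ∷ l)) eq
          (Adjs-suffix (t₁ ∷ x₀ ∷ b) t₂ (d ++ [ t₁ ]) (adj c ∘ edge)))))
      adjs : Adjs (t₂ ∷ (reverse (x₀ ∷ b) ++ d) ++ [ t₁ ])
      adjs = subst (λ l → Adjs (t₂ ∷ l))
        (begin
          reverse b ++ x₀ ∷ d ++ [ t₁ ]             ≡⟨ ++-assoc (reverse b) [ x₀ ] (d ++ [ t₁ ]) ⟨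
          (reverse b ++ [ x₀ ]) ++ (d ++ [ t₁ ])    ≡⟨ cong (_++ (d ++ [ t₁ ])) (unfold-reverse x₀ b) ⟨
          reverse (x₀ ∷ b) ++ (d ++ [ t₁ ])         ≡⟨ ++-assoc (reverse (x₀ ∷ b)) d [ t₁ ] ⟨
          (reverse (x₀ ∷ b) ++ d) ++ [ t₁ ]         ∎)
        (Adjs-join (t₂ ∷ reverse b) x₀ (d ++ [ t₁ ]) backward forward)
        where open ≡-Reasoning
    ...   | no x₀≁y₀ = inj₂ λ _ _ p q → (λ x≡t₂ → x₀≢t₂ (trans (x₀≡ p) x≡t₂)) ,
              subst₂ (λ x y → ¬ Adj G x y) (x₀≡ p) (y₀≡ q) x₀≁y₀
      where
      x₀≡ : ∀ {x} → Next Z t₁ x → x₀ ≡ x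
      x₀≡ = next-functional Z (unique c) (edge (here refl))
      y₀≡ : ∀ {y} → Next Z t₂ y → y₀ ≡ y
      y₀≡ = next-functional Z (unique c) (edge (subst ((t₂ , y₀) ∈_)
        (sym (steps-++ (t₁ ∷ x₀ ∷ b) t₂ (d ++ [ t₁ ])))
        (∈-++⁺ʳ (steps ((t₁ ∷ x₀ ∷ b) ++ [ t₂ ]))
          (subst (λ l → (t₂ , y₀) ∈ steps (t₂ ∷ l)) (sym eq) (here refl)))))
      x₀≢t₂ : x₀ ≢ t₂
      x₀≢t₂ e with Unique-resp-↭ perm (unique c)
      ... | _ ∷ u = Unique[x∷xs]⇒x∉xs u (subst (_∈ b ++ t₂ ∷ d) (sym e) (∈-insert b))

  Independent : List V → Set
  Independent I = ∀ {x y} → x ∈ I → y ∈ I → ¬ Adj G x y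

  -- Distinct ends have distinct successors, and `Uncrossed` makes these pairwise non-adjacent. The
  -- result `R` is left open because it is `Longer Z` for paths from outside and `Extension Z [ i ]`
  -- for a single inserted vertex.
  fan : ∀ {R : Set} {Z} → Circuit Z → ∀ T → Unique T → (∀ {t} → t ∈ T → t ∈ Z) →
    (∀ {t₁ t₂} → t₁ ∈ T → t₂ ∈ T → t₁ ≢ t₂ → R ⊎ Uncrossed Z t₁ t₂) →
    R ⊎ ∃ λ X → length X ≡ length T × Unique X × Independent X ×
      (∀ {x} → x ∈ X → ∃ λ t → t ∈ T × Next Z t x)
  fan {R} {Z} c T uT T⊆ uncrossed
    with sequence T (λ {t₁} t₁∈ → sequence T (λ {t₂} t₂∈ → distinct t₁∈ t₂∈))
    where
    distinct : ∀ {t₁ t₂} → t₁ ∈ T → t₂ ∈ T → R ⊎ (t₁ ≢ t₂ → Uncrossed Z t₁ t₂)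
    distinct {t₁} {t₂} t₁∈ t₂∈ with t₁ ≟ t₂
    ... | yes e = inj₂ λ ne → contradiction e ne
    ... | no ne = map₂ (λ u _ → u) (uncrossed t₁∈ t₂∈ ne)
  ... | inj₁ r = inj₁ r
  ... | inj₂ u with successors Z (unique c) T uT T⊆
  ...   | X , len , uX , back = inj₂ (X , len , uX , indep , back)
    where
    indep : Independent X
    indep x∈ y∈ e with back x∈ | back y∈
    ... | t , t∈ , p | t′ , t′∈ , q with t ≟ t′
    ...   | yes refl = adj-irrefl G (next-functional Z (unique c) p q) e
    ...   | no t≢t′  = proj₂ (u t∈ t′∈ t≢t′ _ _ p q) e

  next≢ : ∀ {Z x y} → Circuit Z → Next Z x y → x ≢ y
  next≢ c p refl = adj-irrefl G refl (adj c p)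

-- Vertex lists as deleted subsets

∣p∪q∣≤∣p∣+∣q∣ : (p q : Subset n) → ∣ p ∪ₛ q ∣ ≤ ∣ p ∣ + ∣ q ∣
∣p∪q∣≤∣p∣+∣q∣ []          []          = z≤n
∣p∪q∣≤∣p∣+∣q∣ (true ∷ p)  (true ∷ q)  =
  s≤s (ℕ.≤-trans (∣p∪q∣≤∣p∣+∣q∣ p q) (ℕ.+-monoʳ-≤ ∣ p ∣ (ℕ.n≤1+n _)))
∣p∪q∣≤∣p∣+∣q∣ (true ∷ p)  (false ∷ q) = s≤s (∣p∪q∣≤∣p∣+∣q∣ p q)
∣p∪q∣≤∣p∣+∣q∣ (false ∷ p) (true ∷ q)  =
  ℕ.≤-trans (s≤s (∣p∪q∣≤∣p∣+∣q∣ p q)) (ℕ.≤-reflexive (sym (ℕ.+-suc ∣ p ∣ ∣ q ∣)))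
∣p∪q∣≤∣p∣+∣q∣ (false ∷ p) (false ∷ q) = ∣p∪q∣≤∣p∣+∣q∣ p q

-- Translates lists into the subsets whose deletion defines connectivity. An upper bound on the size
-- is enough, so repetitions in `T` do no harm.
toSubset : (T : List (Fin n)) →
  ∃ λ S → ∣ S ∣ ≤ length T × (∀ {v} → v ∈ₛ S → v ∈ T) × (∀ {v} → v ∈ T → v ∈ₛ S)
toSubset {n} [] = ⊥ , ℕ.≤-reflexive (∣⊥∣≡0 n) , (λ v∈ → contradiction v∈ ∉⊥) , λ ()
toSubset (t ∷ T) with toSubset T
... | S , le , back , forth = ⁅ t ⁆ ∪ₛ S ,
  ℕ.≤-trans (∣p∪q∣≤∣p∣+∣q∣ ⁅ t ⁆ S) (ℕ.+-mono-≤ (ℕ.≤-reflexive (∣⁅x⁆∣≡1 t)) le) ,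
  (λ v∈ → [ here ∘ x∈⁅y⁆⇒x≡y t , there ∘ back ]′ (x∈p∪q⁻ ⁅ t ⁆ S v∈)) ,
  λ { (here refl) → x∈p∪q⁺ (inj₁ (x∈⁅x⁆ t)) ; (there v∈) → x∈p∪q⁺ (inj₂ (forth v∈)) }

-- Connectivity, and fans from a vertex to a circuit

module Connectivity {n} (G : Graph (Fin n)) where

  open Circuits G

  private V = Fin n

  open DecPropositional (_≟_ {n}) using (_∈?_)

  length≤n : {xs : List V} → Unique xs → length xs ≤ n
  length≤n {xs} u = subst (length xs ≤_) (length-tabulate id) (length-⊆ u (λ {v} _ → ∈-allFin v))

  covers⊎misses : (xs : List V) → (∀ v → v ∈ xs) ⊎ ∃ λ v → v ∉ xs
  covers⊎misses xs with all? (λ v → v ∈? xs)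
  ... | yes f = inj₁ f
  ... | no ¬f = inj₂ (¬∀⟶∃¬ n _ (λ v → v ∈? xs) ¬f)

  shorter-misses : (xs : List V) → length xs < n → ∃ λ v → v ∉ xs
  shorter-misses xs lt with covers⊎misses xs
  ... | inj₂ m = m
  ... | inj₁ f = contradiction
    (subst (_≤ length xs) (length-tabulate id) (length-⊆ (allFin⁺ n) (λ {v} _ → f v))) (ℕ.<⇒≱ lt)

  neighbours : V → List V
  neighbours v = filter (adj? G v) (allFin n)

  neighbours-unique : ∀ v → Unique (neighbours v)
  neighbours-unique v = Unique-filter⁺ (adj? G v) (allFin⁺ n)

  ∈-neighbours⁺ : ∀ {v w} → Adj G v w → w ∈ neighbours v
  ∈-neighbours⁺ {v} {w} e = ∈-filter⁺ (adj? G v) (∈-allFin w) e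

  ∈-neighbours⁻ : ∀ {v w} → w ∈ neighbours v → Adj G v w
  ∈-neighbours⁻ {v} w∈ = proj₂ (∈-filter⁻ (adj? G v) {xs = allFin n} w∈)

  -- Were there fewer than `k` neighbours, deleting them would cut `v` off from a further vertex
  -- `w`, which exists because `n > k`.
  minDegree : ∀ {k} → k -Connected G → ∀ v → k ≤ length (neighbours v)
  minDegree {k} (n>k , conn) v with k ℕ.≤? length (neighbours v)
  ... | yes le = le
  ... | no ¬le with toSubset (neighbours v) | shorter-misses (v ∷ neighbours v) (ℕ.≤-<-trans (ℕ.≰⇒> ¬le) n>k)
  ...   | S , ∣S∣≤ , back , forth | w , w∉
          with conn S (ℕ.≤-<-trans ∣S∣≤ (ℕ.≰⇒> ¬le))
                 (v , λ v∈ → adj-irrefl G refl (∈-neighbours⁻ (back v∈))) (w , w∉ ∘ there ∘ back)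
  ...     | ε = contradiction (here refl) w∉
  ...     | _◅_ {j = u , u∉} e _ = contradiction (forth (∈-neighbours⁺ e)) u∉

  Avoiding : List V → V → V → Set
  Avoiding Z x y = x ∉ Z × y ∉ Z × Adj G x y

  Path : List V → V → V → Set
  Path Z = Star (Avoiding Z)

  Path-sym : ∀ {Z x y} → Path Z x y → Path Z y x
  Path-sym = Star.reverse λ (x∉ , y∉ , e) → y∉ , x∉ , adj-sym G e

  -- Loop erasure: if `x` occurs again on the shortened rest of the path, everything before that
  -- occurrence is dropped. The end `t` is kept apart, since it will lie on `Z`.
  simplePath : ∀ {Z x y t} → x ∉ Z → Path Z x y → Adj G y t →
    ∃ λ ps → Unique (x ∷ ps) × (∀ {v} → v ∈ x ∷ ps → v ∉ Z) × Adjs (x ∷ ps ++ [ t ])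
  simplePath x∉ ε y~t = [] , [] ∷ [] , (λ { (here refl) → x∉ }) , λ { (here refl) → y~t }
  simplePath {x = x} {t = t} x∉ (_◅_ {j = x′} (_ , x′∉ , e) p) y~t with simplePath x′∉ p y~t
  ... | ps , u , out , adjs with x ∈? (x′ ∷ ps)
  ...   | no x∉ps = x′ ∷ ps , Unique-∷ x∉ps u ,
            (λ { (here refl) → x∉ ; (there v∈) → out v∈ }) , Adjs-∷ _ e adjs
  ...   | yes x∈ps with ∈-∃++ x∈ps
  ...     | as , bs , eq = bs , Unique-suffix as (subst Unique eq u) ,
              (λ v∈ → out (subst (_ ∈_) (sym eq) (∈-++⁺ʳ as v∈))) ,
              Adjs-suffix as x (bs ++ [ t ]) (subst Adjs (trans (cong (_++ [ t ]) eq) (++-assoc as (x ∷ bs) [ t ])) adjs)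
    where
    Unique-suffix : ∀ as {bs : List V} → Unique (as ++ bs) → Unique bs
    Unique-suffix []       u       = u
    Unique-suffix (_ ∷ as) (_ ∷ u) = Unique-suffix as u

  -- The last step is separated because it alone may enter `Z`; `y` may be `h` itself.
  Reach : List V → V → V → Set
  Reach Z h t = ∃ λ y → y ∉ Z × Path Z h y × Adj G y t

  Longer : List V → Set
  Longer Z = ∃ λ Z′ → Circuit Z′ × length Z < length Z′

  -- The two paths are joined at `h` and made simple. Loop erasure may discard `h`, but `y` remains
  -- and lies outside `Z`, so the circuit does become longer.
  cross-reach : ∀ {Z h t₁ t₂} → Circuit Z → t₁ ∈ Z → t₂ ∈ Z → t₁ ≢ t₂ →
    Reach Z h t₁ → Reach Z h t₂ → Longer Z ⊎ Uncrossed Z t₁ t₂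
  cross-reach c t₁∈ t₂∈ t₁≢t₂ (y , y∉ , p , e) (y′ , y′∉ , p′ , e′)
    with simplePath y∉ (Path-sym p ◅◅ p′) e′
  ... | ps , u , out , adjs with cross c t₁∈ t₂∈ t₁≢t₂ (y ∷ ps) u out (Adjs-∷ _ (adj-sym G e) adjs)
  ...   | inj₂ unc = inj₂ unc
  ...   | inj₁ (Z′ , c′ , Z⊆ , P⊆) = inj₁ (Z′ , c′ ,
            length-⊆ (Unique-∷ (out (here refl)) (unique c)) λ { (here refl) → P⊆ (here refl) ; (there v∈) → Z⊆ v∈ })

  -- After deletion of `T` there is still a walk from `h` to `c`; its first vertex on `Z` is the
  -- required `w`.
  escape : ∀ {k Z h T c} → k -Connected G → h ∉ Z → length T < k → (∀ {t} → t ∈ T → t ∈ Z) →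
    c ∈ Z → c ∉ T → ∃ λ w → w ∈ Z × w ∉ T × Reach Z h w
  escape {k} {Z} {h} {T} {c} (_ , conn) h∉ lt T⊆ c∈ c∉ with toSubset T
  ... | S , ∣S∣≤ , back , forth =
        go h∉ ε (conn S (ℕ.≤-<-trans ∣S∣≤ lt) (h , h∉ ∘ T⊆ ∘ back) (c , c∉ ∘ back))
    where
    go : ∀ {u u∉S c∉S} → u ∉ Z → Path Z h u → Star (Adj (G − S)) (u , u∉S) (c , c∉S) →
      ∃ λ w → w ∈ Z × w ∉ T × Reach Z h w
    go u∉ p ε = contradiction c∈ u∉
    go {u} u∉ p (_◅_ {j = w , w∉S} e q) with w ∈? Z
    ... | yes w∈ = w , w∈ , (λ w∈T → w∉S (forth w∈T)) , u , u∉ , p , e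
    ... | no w∉  = go w∉ (p ◅◅ (u∉ , w∉ , e) ◅ ε) q

  inhabited : ∀ {Z} → Circuit Z → ∃ λ v → v ∈ Z
  inhabited {[]}    c = contradiction (length≥2 c) λ ()
  inhabited {z ∷ _} c = z , here refl

  Fan : List V → V → ℕ → Set
  Fan Z h j = ∃ λ T → length T ≡ j × Unique T × (∀ {t} → t ∈ T → t ∈ Z) × (∀ {t} → t ∈ T → Reach Z h t)

  growFan : ∀ {k Z h} → k -Connected G → Circuit Z → h ∉ Z → ∀ j → j ≤ k → Longer Z ⊎ Fan Z h j
  growFan kc c h∉ zero    _   = inj₂ ([] , refl , [] , (λ ()) , λ ())
  growFan {k} {Z} {h} kc c h∉ (suc j) j<k with growFan kc c h∉ j (ℕ.<⇒≤ j<k)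
  ... | inj₁ l = inj₁ l
  ... | inj₂ (T , refl , uT , T⊆ , reach) with free T T⊆ reach
    where
    -- `Z` may be short, so a vertex of `Z` outside `T` has to be found. The successor of any end in
    -- `T` serves, unless it is an end too; then two consecutive vertices are reached and a detour
    -- between them enlarges `Z`.
    free : ∀ T → (∀ {t} → t ∈ T → t ∈ Z) → (∀ {t} → t ∈ T → Reach Z h t) →
      Longer Z ⊎ ∃ λ v → v ∈ Z × v ∉ T
    free [] _ _ = inj₂ (proj₁ (inhabited c) , proj₂ (inhabited c) , λ ())
    free (t ∷ T) T⊆ reach with next-total Z (T⊆ (here refl))
    ... | x , p with x ∈? (t ∷ T)
    ...   | no x∉  = inj₂ (x , next-target Z p , x∉)
    ...   | yes x∈ with cross-reach c (T⊆ (here refl)) (T⊆ x∈) (next≢ c p) (reach (here refl)) (reach x∈)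
    ...     | inj₁ l = inj₁ l
    ...     | inj₂ unc = contradiction refl (proj₁ (unc _ _ p (proj₂ (next-total Z (T⊆ x∈)))))
  ...   | inj₁ l = inj₁ l
  ...   | inj₂ (v , v∈ , v∉) with escape kc h∉ j<k T⊆ v∈ v∉
  ...     | w , w∈ , w∉ , r = inj₂ (w ∷ T , refl , Unique-∷ w∉ uT ,
              (λ { (here refl) → w∈ ; (there t∈) → T⊆ t∈ }) , λ { (here refl) → r ; (there t∈) → reach t∈ })

  IndependentSet : ℕ → Set
  IndependentSet m = ∃ λ I → length I ≡ m × Unique I × Independent I

  longer⊎independent : ∀ {k Z h} → k -Connected G → Circuit Z → h ∉ Z → Longer Z ⊎ IndependentSet (suc k)
  longer⊎independent {k} {Z} {h} kc c h∉ with growFan kc c h∉ k ℕ.≤-refl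
  ... | inj₁ l = inj₁ l
  ... | inj₂ (T , refl , uT , T⊆ , reach)
      with fan c T uT T⊆ (λ t₁∈ t₂∈ ne → cross-reach c (T⊆ t₁∈) (T⊆ t₂∈) ne (reach t₁∈) (reach t₂∈))
  ...   | inj₁ l = inj₁ l
  ...   | inj₂ (X , len , uX , indep , back) with sequence X nonadjacent
    where
    -- If `h` were adjacent to the successor `x` of `t`, both `t` and `x` would be reached from `h`,
    -- and the edge between them could be replaced by a detour.
    nonadjacent : ∀ {x} → x ∈ X → Longer Z ⊎ ¬ Adj G h x
    nonadjacent {x} x∈ with adj? G h x | back x∈
    ... | no h≁x | _ = inj₂ h≁x
    ... | yes h~x | t , t∈ , p
        with cross-reach c (T⊆ t∈) (next-target Z p) (next≢ c p) (reach t∈) (h , h∉ , ε , h~x)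
    ...   | inj₁ l   = inj₁ l
    ...   | inj₂ unc = contradiction refl (proj₁ (unc _ _ p (proj₂ (next-total Z (next-target Z p)))))
  ...     | inj₁ l = inj₁ l
  ...     | inj₂ h≁ = inj₂ (h ∷ X , cong suc len , Unique-∷ h∉X uX , λ where
              (here refl) (here refl) → adj-irrefl G refl
              (here refl) (there y∈)  → h≁ y∈
              (there x∈)  (here refl) → h≁ x∈ ∘ adj-sym G
              (there x∈)  (there y∈)  → indep x∈ y∈)
    where
    h∉X : h ∉ X
    h∉X h∈ = h∉ (next-target Z (proj₂ (proj₂ (back h∈))))

  edgeCircuit : ∀ {u v} → Adj G u v → Circuit (u ∷ v ∷ [])
  edgeCircuit e .unique   = Unique-∷ (λ { (here refl) → adj-irrefl G refl e }) ([] ∷ [])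
  edgeCircuit e .length≥2 = s≤s (s≤s z≤n)
  edgeCircuit e .adj (here refl)         = e
  edgeCircuit e .adj (there (here refl)) = adj-sym G e

  Adjs⇒Linked : ∀ xs → Adjs xs → Linked (Adj G) xs
  Adjs⇒Linked []           f = []
  Adjs⇒Linked (x ∷ [])     f = [-]
  Adjs⇒Linked (x ∷ y ∷ xs) f = f (here refl) ∷ Adjs⇒Linked (y ∷ xs) (f ∘ there)

  -- The bound `n ≥ 3` excludes the single edge traversed twice that `Circuit` allows.
  covering⇒Hamiltonian : ∀ {Z} → n ≥ 3 → Circuit Z → (∀ v → v ∈ Z) → Hamiltonian G
  covering⇒Hamiltonian {[]} _ c = contradiction (length≥2 c) λ ()
  covering⇒Hamiltonian {z ∷ zs} n≥3 c f = z , zs , record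
    { length≥3 = ℕ.≤-trans n≥3
        (subst (_≤ length (z ∷ zs)) (length-tabulate id) (length-⊆ (allFin⁺ n) (λ {v} _ → f v)))
    ; distinct = unique c
    ; adjacent = Adjs⇒Linked (z ∷ zs ++ [ z ]) (adj c)
    } , f

  Hamiltonian⊎independent : ∀ {k} → k ≥ 2 → k -Connected G → Hamiltonian G ⊎ IndependentSet (suc k)
  Hamiltonian⊎independent {k} k≥2 kc@(n>k , _)
    with shorter-misses [] (ℕ.≤-<-trans z≤n n>k)
  ... | u , _ with neighbours u in eq | ℕ.≤-trans k≥2 (minDegree kc u)
  ...   | v ∷ _ | _ = loop n (ℕ.m≤m+n n 2) (edgeCircuit {u} {v} (∈-neighbours⁻ (subst (v ∈_) (sym eq) (here refl))))
    where
    -- `fuel` bounds the number of vertices still missing from `Z`, so at zero nothing can be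
    -- missed.
    loop : ∀ fuel {Z} → n ≤ fuel + length Z → Circuit Z → Hamiltonian G ⊎ IndependentSet (suc k)
    loop fuel {Z} bound c with covers⊎misses Z
    ... | inj₁ f = inj₁ (covering⇒Hamiltonian (ℕ.≤-trans (s≤s k≥2) n>k) c f)
    loop zero       bound c | inj₂ (h , h∉) = contradiction (length≤n (Unique-∷ h∉ (unique c))) (ℕ.≤⇒≯ bound)
    loop (suc fuel) {Z} bound c | inj₂ (h , h∉) with longer⊎independent kc c h∉
    ... | inj₂ i = inj₂ i
    ... | inj₁ (Z′ , c′ , lt) = loop fuel
      (ℕ.≤-trans bound (ℕ.≤-trans (ℕ.≤-reflexive (sym (ℕ.+-suc fuel (length Z)))) (ℕ.+-monoʳ-≤ fuel lt))) c′

-- Colourings that save colours on an independent set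

module Colouring {n} (G : Graph (Fin n)) where

  open Circuits G
  open Connectivity G

  private V = Fin n

  open DecPropositional (_≟_ {n}) using (_∈?_)

  others : List V → List V
  others L = filter (λ v → ¬? (v ∈? L)) (allFin n)

  others-unique : ∀ L → Unique (others L)
  others-unique L = Unique-filter⁺ _ (allFin⁺ n)

  ∈-others⁺ : ∀ {L v} → v ∉ L → v ∈ others L
  ∈-others⁺ {L} {v} v∉ = ∈-filter⁺ (λ v → ¬? (v ∈? L)) (∈-allFin v) v∉

  ∈-others⁻ : ∀ {L v} → v ∈ others L → v ∉ L
  ∈-others⁻ {L} v∈ = proj₂ (∈-filter⁻ (λ v → ¬? (v ∈? L)) {xs = allFin n} v∈)

  length-others : ∀ {L} → Unique L → length L + length (others L) ≡ n
  length-others {L} u = trans (sym (length-++ L)) (ℕ.≤-antisym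
    (length≤n (Unique-++⁺ u (others-unique L) λ (p , q) → ∈-others⁻ q p))
    (subst (_≤ length (L ++ others L)) (length-tabulate id) (length-⊆ (allFin⁺ n) λ {v} _ → all v)))
    where
    all : ∀ v → v ∈ L ++ others L
    all v with v ∈? L
    ... | yes v∈ = ∈-++⁺ˡ v∈
    ... | no v∉  = ∈-++⁺ʳ L (∈-others⁺ v∉)

  -- Vertices of `R` serve as colours; their positions in `R` give the numbering required by
  -- `Colorable`.
  χ≤length : (R : List V) (f : V → V) → (∀ v → f v ∈ R) → (∀ {x y} → Adj G x y → f x ≢ f y) →
    χ G ≤ length R
  χ≤length R f f∈ proper = proj₂ (proj₂ (chromaticNumber G)) (length R)
    ((λ v → Any.index (f∈ v)) , λ x y e eq → proper e (index-injective (setoid V) (f∈ x) (f∈ y) eq))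

  module _ {k} (χ≥ : χ G ≥ n ∸ k) {I : List V} (uI : Unique I) (∣I∣ : length I ≡ suc k)
           (indep : Independent I) where

    -- Otherwise one colour for I, one for u and w, and one for each other vertex
    -- would be n ∸ suc k colours.
    outside-clique : ∀ {u w} → u ∉ I → w ∉ I → u ≢ w → Adj G u w
    outside-clique {u} {w} u∉ w∉ u≢w with adj? G u w
    ... | yes e = e
    ... | no u≁w = contradiction χ≥ (ℕ.<⇒≱ (ℕ.≤-<-trans (χ≤length (i₀ ∷ R) (proj₁ ∘ colour) colour∈ proper) few))
      where
      nonempty : ∃ (_∈ I)
      nonempty = ∈-length⁻ ∣I∣
        where
        ∈-length⁻ : ∀ {I : List V} → length I ≡ suc k → ∃ (_∈ I)
        ∈-length⁻ {i ∷ _} _ = i , here refl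
      i₀ : V
      i₀ = proj₁ nonempty
      i₀∈ : i₀ ∈ I
      i₀∈ = proj₂ nonempty
      R : List V
      R = others (w ∷ I)
      -- `w ∷ I` consists of `k + 2` distinct vertices, so `R` has `n ∸ (k + 2)` entries and `i₀`
      -- adds one more colour.
      few : suc (length R) < n ∸ k
      few = ℕ.≤-reflexive (begin
        suc (suc (length R))             ≡⟨ ℕ.m+n∸m≡n k _ ⟨
        k + (2 + length R) ∸ k           ≡⟨ cong (_∸ k) (trans (ℕ.+-suc k _) (cong suc (ℕ.+-suc k _))) ⟩
        suc (suc k) + length R ∸ k       ≡⟨ cong (λ m → suc m + length R ∸ k) ∣I∣ ⟨
        length (w ∷ I) + length R ∸ k    ≡⟨ cong (_∸ k) (length-others (Unique-∷ w∉ uI)) ⟩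
        n ∸ k                            ∎)
        where open ≡-Reasoning
      -- Each colour class is named by one of its vertices: `i₀` for `I`, `u` for `u` and `w`.
      -- Keeping the reason in the type lets `proper` go through all pairs of cases.
      Colour : V → V → Set
      Colour v c = (v ∈ I × c ≡ i₀) ⊎ (v ≡ w × c ≡ u) ⊎ (v ∉ w ∷ I × c ≡ v)
      colour : ∀ v → ∃ (Colour v)
      colour v with v ∈? I | v ≟ w
      ... | yes v∈ | _      = i₀ , inj₁ (v∈ , refl)
      ... | no _   | yes e  = u , inj₂ (inj₁ (e , refl))
      ... | no v∉  | no v≢w = v , inj₂ (inj₂ ([ v≢w , v∉ ]′ ∘ Any.toSum , refl))
      colour∈ : ∀ v → proj₁ (colour v) ∈ i₀ ∷ R
      colour∈ v with colour v
      ... | _ , inj₁ (_ , refl) = here refl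
      ... | _ , inj₂ (inj₁ (_ , refl)) = there (∈-others⁺ ([ u≢w , u∉ ]′ ∘ Any.toSum))
      ... | _ , inj₂ (inj₂ (v∉ , refl)) = there (∈-others⁺ v∉)
      proper : ∀ {x y} → Adj G x y → proj₁ (colour x) ≢ proj₁ (colour y)
      proper {x} {y} e eq with colour x | colour y
      proper e eq   | _ , inj₁ (x∈ , _)             | _ , inj₁ (y∈ , _)             = indep x∈ y∈ e
      proper e refl | _ , inj₁ (_ , refl)           | _ , inj₂ (inj₁ (_ , eq))      = u∉ (subst (_∈ I) eq i₀∈)
      proper e refl | _ , inj₁ (_ , refl)           | _ , inj₂ (inj₂ (y∉ , refl))   = y∉ (there i₀∈)
      proper e refl | _ , inj₂ (inj₁ (_ , eq))      | _ , inj₁ (_ , refl)           = u∉ (subst (_∈ I) eq i₀∈)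
      proper e eq   | _ , inj₂ (inj₁ (refl , _))    | _ , inj₂ (inj₁ (refl , _))    = adj-irrefl G refl e
      proper e refl | _ , inj₂ (inj₁ (refl , refl)) | _ , inj₂ (inj₂ (_ , refl))    = u≁w (adj-sym G e)
      proper e refl | _ , inj₂ (inj₂ (x∉ , refl))   | _ , inj₁ (_ , refl)           = x∉ (there i₀∈)
      proper e refl | _ , inj₂ (inj₂ (_ , refl))    | _ , inj₂ (inj₁ (refl , refl)) = u≁w e
      proper e refl | _ , inj₂ (inj₂ (_ , refl))    | _ , inj₂ (inj₂ (_ , refl))    = adj-irrefl G refl e

    -- Otherwise every vertex of I could share the colour of a non-neighbour outside I.
    dominating : ∃ λ v → v ∈ I × (∀ {q} → q ∉ I → Adj G v q)
    dominating with sequence I shared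
      where
      shared : ∀ {v} → v ∈ I → (∃ λ v → v ∈ I × (∀ {q} → q ∉ I → Adj G v q)) ⊎ ∃ λ q → q ∉ I × ¬ Adj G v q
      shared {v} v∈ with All.all? (adj? G v) (others I)
      ... | yes all = inj₁ (v , v∈ , All.lookup all ∘ ∈-others⁺)
      ... | no ¬all with find (¬All⇒Any¬ (adj? G v) (others I) ¬all)
      ...   | q , q∈ , v≁q = inj₂ (q , ∈-others⁻ q∈ , v≁q)
    ... | inj₁ d = d
    ... | inj₂ partner = contradiction χ≥ (ℕ.<⇒≱ (ℕ.≤-<-trans (χ≤length (others I) (proj₁ ∘ colour) colour∈ proper) few))
      where
      few : length (others I) < n ∸ k
      few = ℕ.≤-reflexive (begin
        suc (length (others I))          ≡⟨ ℕ.m+n∸m≡n k _ ⟨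
        k + suc (length (others I)) ∸ k  ≡⟨ cong (_∸ k) (ℕ.+-suc k _) ⟩
        suc k + length (others I) ∸ k    ≡⟨ cong (λ m → m + length (others I) ∸ k) ∣I∣ ⟨
        length I + length (others I) ∸ k ≡⟨ cong (_∸ k) (length-others uI) ⟩
        n ∸ k                            ∎)
        where open ≡-Reasoning
      colour : ∀ v → ∃ λ c → c ∉ I × ((v ∈ I × ¬ Adj G v c) ⊎ (v ∉ I × c ≡ v))
      colour v with v ∈? I
      ... | no v∉  = v , v∉ , inj₂ (v∉ , refl)
      ... | yes v∈ with partner v∈
      ...   | q , q∉ , v≁q = q , q∉ , inj₁ (v∈ , v≁q)
      colour∈ : ∀ v → proj₁ (colour v) ∈ others I
      colour∈ v = ∈-others⁺ (proj₁ (proj₂ (colour v)))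
      proper : ∀ {x y} → Adj G x y → proj₁ (colour x) ≢ proj₁ (colour y)
      proper {x} {y} e eq with colour x | colour y
      proper e eq   | _ , _ , inj₁ (x∈ , _)   | _ , _ , inj₁ (y∈ , _)   = indep x∈ y∈ e
      proper e refl | _ , _ , inj₁ (_ , x≁c)  | _ , _ , inj₂ (_ , refl) = x≁c e
      proper e refl | _ , _ , inj₂ (_ , refl) | _ , _ , inj₁ (_ , y≁c)  = y≁c (adj-sym G e)
      proper e refl | _ , _ , inj₂ (_ , refl) | _ , _ , inj₂ (_ , refl) = adj-irrefl G refl e

-- Split graphs: inserting an independent set into a circuit through a clique

module SplitGraph {n} (G : Graph (Fin n)) where

  open Circuits G
  open Connectivity G
  open Colouring G using (others; ∈-others⁺; ∈-others⁻; others-unique; length-others)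

  private V = Fin n

  open DecPropositional (_≟_ {n}) using (_∈?_)

  remove : V → List V → List V
  remove x = filter (λ y → ¬? (y ≟ x))

  ∈-remove : ∀ {x y L} → y ∈ L → y ≢ x → y ∈ remove x L
  ∈-remove {x} y∈ y≢x = ∈-filter⁺ (λ y → ¬? (y ≟ x)) y∈ y≢x

  length-remove : ∀ {x} L → x ∈ L → length (remove x L) < length L
  length-remove {x} L x∈ = filter-notAll (λ y → ¬? (y ≟ x)) L (lose x∈ λ x≢ → x≢ refl)

  module _ {k} (k≥2 : k ≥ 2) (minDeg : ∀ v → k ≤ length (neighbours v))
    {C I : List V} (uC : Unique C) (uI : Unique I) (∣I∣ : length I ≡ k) (∣C∣ : length C > k)
    (covered : ∀ v → v ∈ C ⊎ v ∈ I) (disjoint : ∀ {v} → v ∈ C → v ∉ I)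
    (clique : ∀ {x y} → x ∈ C → y ∈ C → x ≢ y → Adj G x y) (indep : Independent I) where

    neighbours⊆C : ∀ {i t} → i ∈ I → t ∈ neighbours i → t ∈ C
    neighbours⊆C {t = t} i∈ t∈ with covered t
    ... | inj₁ t∈C = t∈C
    ... | inj₂ t∈I = contradiction (∈-neighbours⁻ t∈) (indep i∈ t∈I)

    clique-circuit : Circuit C
    clique-circuit .unique   = uC
    clique-circuit .length≥2 = ℕ.≤-trans k≥2 (ℕ.<⇒≤ ∣C∣)
    clique-circuit .adj p    = clique (next-source C p) (next-target C p)
      λ { refl → next-irrefl C uC (ℕ.≤-trans k≥2 (ℕ.<⇒≤ ∣C∣)) p }

    -- It also records that every vertex of `I` other than `i` lies on `Z`.
    Preceded : List V → V → Set
    Preceded Z i = ∀ {x} → x ∈ I → x ≢ i → ∃ λ t → t ∈ neighbours i × Next Z t x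

    Followed : List V → V → Set
    Followed Z i = ∀ {x} → x ∈ I → x ≢ i → ∃ λ t → t ∈ neighbours i × Next Z x t

    -- The successors of the neighbours of i are independent, so all but one of
    -- these at least k vertices lie in I, which has only k ∸ 1 vertices besides i.
    insert-forward : ∀ {Z i} → Circuit Z → (∀ {v} → v ∈ C → v ∈ Z) → i ∈ I → i ∉ Z →
      Extension Z [ i ] ⊎ (length (neighbours i) ≤ k × Preceded Z i)
    insert-forward {Z} {i} c C⊆ i∈ i∉ with fan c (neighbours i) (neighbours-unique i) (C⊆ ∘ neighbours⊆C i∈) uncrossed
      where
      uncrossed : ∀ {t₁ t₂} → t₁ ∈ neighbours i → t₂ ∈ neighbours i → t₁ ≢ t₂ →
        Extension Z [ i ] ⊎ Uncrossed Z t₁ t₂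
      uncrossed t₁∈ t₂∈ ne = cross c (C⊆ (neighbours⊆C i∈ t₁∈)) (C⊆ (neighbours⊆C i∈ t₂∈)) ne [ i ]
        ([] ∷ []) (λ { (here refl) → i∉ }) λ where
          (here refl)         → adj-sym G (∈-neighbours⁻ t₁∈)
          (there (here refl)) → ∈-neighbours⁻ t₂∈
    ... | inj₁ ext = inj₁ ext
    ... | inj₂ (X , len , uX , indepX , back) = inj₂
      ( subst (_≤ k) len (ℕ.≤-trans (length-⊆ uX X⊆) (subst (length (remove i I) <_) ∣I∣ (length-remove I i∈)))
      , preceded)
      where
      exception : ∃ λ x₀ → ∀ {x} → x ∈ X → x ≡ x₀ ⊎ x ∈ I
      exception with Any.any? (_∈? C) X
      -- There is no exception here, and `i` is a dummy value; one spare entry does not hurt the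
      -- count.
      ... | no ∄ = i , λ {x} x∈ → inj₂ ([ (λ x∈C → contradiction (lose x∈ x∈C) ∄) , id ]′ (covered x))
      ... | yes ∃X with find ∃X
      ...   | x₀ , x₀∈X , x₀∈C = x₀ , only
        where
        only : ∀ {x} → x ∈ X → x ≡ x₀ ⊎ x ∈ I
        only {x} x∈ with covered x | x ≟ x₀
        ... | inj₂ x∈I | _ = inj₂ x∈I
        ... | inj₁ _   | yes e = inj₁ e
        ... | inj₁ x∈C | no ne = contradiction (clique x∈C x₀∈C ne) (indepX x∈ x₀∈X)
      x₀ : V
      x₀ = proj₁ exception
      x≢i : ∀ {x} → x ∈ X → x ≢ i
      x≢i x∈ refl = i∉ (next-target Z (proj₂ (proj₂ (back x∈))))
      X⊆ : ∀ {x} → x ∈ X → x ∈ x₀ ∷ remove i I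
      X⊆ x∈ with proj₂ exception x∈
      ... | inj₁ e   = here e
      ... | inj₂ x∈I = there (∈-remove x∈I (x≢i x∈))
      preceded : Preceded Z i
      preceded {x} x∈ x≢ with x ∈? X
      ... | yes x∈X = back x∈X
      -- If `x` is missing, `X` fits into `x₀` and `I` without `i` and `x`, which is at most `k ∸ 1`
      -- vertices, although `i` has at least `k` neighbours.
      ... | no x∉X = contradiction (subst (k ≤_) (sym len) (minDeg i)) (ℕ.<⇒≱ (begin-strict
        length X                            ≤⟨ length-⊆ uX X⊆′ ⟩
        suc (length (remove x (remove i I))) ≤⟨ length-remove (remove i I) (∈-remove x∈ x≢) ⟩
        length (remove i I)                 <⟨ length-remove I i∈ ⟩
        length I                            ≡⟨ ∣I∣ ⟩
        k                                   ∎))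
        where
        open ℕ.≤-Reasoning
        X⊆′ : ∀ {y} → y ∈ X → y ∈ x₀ ∷ remove x (remove i I)
        X⊆′ y∈ with X⊆ y∈
        ... | here e   = here e
        ... | there y∈′ = there (∈-remove y∈′ λ { refl → x∉X y∈ })

    -- Traversing the circuit backwards turns the statement about predecessors into the one about
    -- successors.
    insert : ∀ {Z i} → Circuit Z → (∀ {v} → v ∈ C → v ∈ Z) → i ∈ I → i ∉ Z →
      Extension Z [ i ] ⊎ (length (neighbours i) ≤ k × Preceded Z i × Followed Z i)
    insert {Z} {i} c C⊆ i∈ i∉ with insert-forward c C⊆ i∈ i∉
    ... | inj₁ ext = inj₁ ext
    ... | inj₂ (le , prec)
        with insert-forward (Circuit-reverse c) (∈-resp-↭ (↭-sym (reverseCycle-↭ Z)) ∘ C⊆) i∈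
               (i∉ ∘ ∈-resp-↭ (reverseCycle-↭ Z))
    ...   | inj₁ (Z′ , c′ , Z⊆ , i∈′) = inj₁ (Z′ , c′ , Z⊆ ∘ ∈-resp-↭ (↭-sym (reverseCycle-↭ Z)) , i∈′)
    ...   | inj₂ (_ , prec′) = inj₂ (le , prec , λ x∈ x≢ →
              let t , t∈ , p = prec′ x∈ x≢ in t , t∈ , next-reverse⁻ Z p)

    -- Exchanging a vertex that cannot be inserted

    module Stuck {Z i} (c : Circuit Z) (C⊆ : ∀ {v} → v ∈ C → v ∈ Z) (i∈ : i ∈ I) (i∉ : i ∉ Z)
      (∣Ni∣≤k : length (neighbours i) ≤ k)
      (prec : Preceded Z i) (foll : Followed Z i) where

      all-but-i : ∀ {v} → v ≢ i → v ∈ Z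
      all-but-i {v} v≢i with covered v
      ... | inj₁ v∈C = C⊆ v∈C
      ... | inj₂ v∈I = next-target Z (proj₂ (proj₂ (prec v∈I v≢i)))

      module Exchange {j} (j∈ : j ∈ I) (j≢i : j ≢ i) where

        -- Not a transposition: `i` stays fixed as well, so `σ` is injective only on lists that omit
        -- `i`, such as `Z`.
        σ : V → V
        σ v with v ≟ j
        ... | yes _ = i
        ... | no _  = v

        σ-j : σ j ≡ i
        σ-j with j ≟ j
        ... | yes _  = refl
        ... | no j≢j = contradiction refl j≢j

        σ-fixes : ∀ {v} → v ≢ j → σ v ≡ v
        σ-fixes {v} v≢j with v ≟ j
        ... | yes e = contradiction e v≢j
        ... | no _  = refl

        σ-injective : ∀ {x y} → x ∈ Z → y ∈ Z → σ x ≡ σ y → x ≡ y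
        σ-injective {x} {y} x∈ y∈ e with x ≟ j | y ≟ j
        ... | yes refl | yes refl = refl
        ... | yes refl | no _     = contradiction (subst (_∈ Z) (sym e) y∈) i∉
        ... | no _     | yes refl = contradiction (subst (_∈ Z) e x∈) i∉
        ... | no _     | no _     = e

        Z′ : List V
        Z′ = map σ Z

        ∈Z′ : ∀ {v} → v ≢ j → v ∈ Z′
        ∈Z′ {v} v≢j with v ≟ i
        ... | yes refl = subst (_∈ Z′) σ-j (∈-map⁺ σ (all-but-i j≢i))
        ... | no v≢i   = subst (_∈ Z′) (σ-fixes v≢j) (∈-map⁺ σ (all-but-i v≢i))

        C≢j : ∀ {v} → v ∈ C → v ≢ j
        C≢j v∈ refl = disjoint v∈ j∈

        σ≢j : ∀ v → σ v ≢ j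
        σ≢j v with v ≟ j
        ... | yes _  = j≢i ∘ sym
        ... | no v≢j = v≢j

        j∉Z′ : j ∉ Z′
        j∉Z′ j∈′ with ∈-map⁻ σ j∈′
        ... | v , _ , e = σ≢j v (sym e)

        circuit′ : Circuit Z′
        circuit′ .unique   = Unique-map-on⁺ σ Z σ-injective (unique c)
        circuit′ .length≥2 = subst (_≥ 2) (sym (length-map σ Z)) (length≥2 c)
        circuit′ .adj p with next-map σ Z p
        ... | a , b , q , refl , refl with a ≟ j | b ≟ j
        ...   | yes refl | yes refl = contradiction refl (next≢ c q)
        -- The vertices next to `j` on `Z` are neighbours of `i`, by `foll` and `prec`, so `i` can
        -- stand in for `j`.
        ...   | yes refl | no _  = let t , t∈ , r = foll j∈ j≢i in
                  subst (Adj G i) (next-functional Z (unique c) r q) (∈-neighbours⁻ t∈)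
        ...   | no _  | yes refl = let t , t∈ , r = prec j∈ j≢i in
                  subst (λ v → Adj G v i) (next-injective Z (unique c) r q) (adj-sym G (∈-neighbours⁻ t∈))
        ...   | no _  | no _     = adj c q

        σ∈I : ∀ {x} → x ∈ I → σ x ∈ I
        σ∈I {x} x∈ with x ≟ j
        ... | yes _ = i∈
        ... | no _  = x∈

        -- Brings a neighbour of `j` found on `Z′` back to `Z`: it lies in `C`, hence is not the
        -- substituted `i`.
        σ-C : ∀ {v} → σ v ∈ C → σ v ≡ v
        σ-C {v} σv∈ with v ≟ j
        ... | yes _ = contradiction i∈ (disjoint σv∈)
        ... | no _  = refl

        -- In Z′ the vertex i takes the place of j, so the constraints on the
        -- neighbours of j concern the same positions as those on the neighbours of i.
        preceded′ : Preceded Z′ j → ∀ {x} → x ∈ I → x ≢ i → ∃ λ t → t ∈ neighbours j × Next Z t x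
        preceded′ prec′ {x} x∈ x≢i with prec′ (σ∈I x∈) (σ≢j x)
        ... | t , t∈ , p with next-map σ Z p
        ...   | a , b , q , refl , e =
                a , subst (_∈ neighbours j) (σ-C (neighbours⊆C j∈ t∈)) t∈ ,
                subst (Next Z a) (σ-injective (next-target Z q) (all-but-i x≢i) (sym e)) q

        followed′ : Followed Z′ j → ∀ {x} → x ∈ I → x ≢ i → ∃ λ t → t ∈ neighbours j × Next Z x t
        followed′ foll′ {x} x∈ x≢i with foll′ (σ∈I x∈) (σ≢j x)
        ... | t , t∈ , p with next-map σ Z p
        ...   | a , b , q , e , refl =
                b , subst (_∈ neighbours j) (σ-C (neighbours⊆C j∈ t∈)) t∈ ,
                subst (λ v → Next Z v b) (σ-injective (next-source Z q) (all-but-i x≢i) (sym e)) q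

      J : List V
      J = proj₁ (rotateTo i∈)

      I↭i∷J : I ↭ i ∷ J
      I↭i∷J = proj₁ (proj₂ (rotateTo i∈))

      uiJ : Unique (i ∷ J)
      uiJ = Unique-resp-↭ I↭i∷J uI

      J≢i : ∀ {x} → x ∈ J → x ≢ i
      J≢i x∈ refl = Unique[x∷xs]⇒x∉xs uiJ x∈

      J⊆I : ∀ {x} → x ∈ J → x ∈ I
      J⊆I = ∈-resp-↭ (↭-sym I↭i∷J) ∘ there

      -- If the predecessors P and the successors of I in Z coincided, then P and I
      -- would alternate around Z. So some successor s lies outside P, and s ∷ P
      -- is the whole neighbourhood of i.
      neighbours-⊆ : ∀ {j} → (∀ {x} → x ∈ I → x ≢ i → ∃ λ t → t ∈ neighbours j × Next Z t x) →
        (∀ {x} → x ∈ I → x ≢ i → ∃ λ t → t ∈ neighbours j × Next Z x t) →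
        ∀ {t} → t ∈ neighbours i → t ∈ neighbours j
      neighbours-⊆ {j} prec′ foll′ {t} t∈ 
        -- Predecessors on `Z` are successors on the reversed circuit. Like `J`, the list `P` has
        -- `k ∸ 1` entries.
        with successors (reverseCycle Z) (Unique-resp-↭ (↭-sym (reverseCycle-↭ Z)) (unique c)) J
                 (AllPairs.tail uiJ) (∈-resp-↭ (↭-sym (reverseCycle-↭ Z)) ∘ all-but-i ∘ J≢i)
      ... | P , ∣P∣≡∣J∣ , uP , back = conclude (sequence J outside)
        where
        1+∣P∣≡k : suc (length P) ≡ k
        1+∣P∣≡k = trans (cong suc ∣P∣≡∣J∣) (trans (sym (↭-length I↭i∷J)) ∣I∣)
        P-next : ∀ {p} → p ∈ P → ∃ λ x → x ∈ J × Next Z p x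
        P-next p∈ = let x , x∈ , q = back p∈ in x , x∈ , next-reverse⁻ Z q
        P⊆ : ∀ {m} → (∀ {x} → x ∈ I → x ≢ i → ∃ λ t → t ∈ neighbours m × Next Z t x) →
          ∀ {p} → p ∈ P → p ∈ neighbours m
        P⊆ {m} pr p∈ with P-next p∈
        ... | x , x∈ , q with pr (J⊆I x∈) (J≢i x∈)
        ...   | t , t∈ , r = subst (_∈ neighbours m) (next-injective Z (unique c) r q) t∈
        Outside : Set
        Outside = ∃ λ s → s ∉ P × s ∈ neighbours i × s ∈ neighbours j
        outside : ∀ {x} → x ∈ J → Outside ⊎ ∃ λ s → Next Z x s × s ∈ P
        outside x∈ with foll (J⊆I x∈) (J≢i x∈) | foll′ (J⊆I x∈) (J≢i x∈)
        ... | s , s∈i , p | s′ , s′∈j , p′ with s ∈? P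
        ...   | yes s∈P = inj₂ (s , p , s∈P)
        ...   | no s∉P  = inj₁ (s , s∉P , s∈i , subst (_∈ neighbours j) (next-functional Z (unique c) p′ p) s′∈j)
        conclude : Outside ⊎ (∀ {x} → x ∈ J → ∃ λ s → Next Z x s × s ∈ P) → t ∈ neighbours j
        conclude (inj₁ (s , s∉P , s∈i , s∈j)) with t ∈? (s ∷ P)
        ... | yes (here refl) = s∈j
        ... | yes (there t∈P) = P⊆ prec′ t∈P
        ... | no t∉ = contradiction
          (length-⊆ (Unique-∷ t∉ (Unique-∷ s∉P uP))
            λ { (here refl) → t∈ ; (there (here refl)) → s∈i ; (there (there p∈)) → P⊆ prec p∈ })
          (ℕ.<⇒≱ (s≤s (subst (length (neighbours i) ≤_) (sym 1+∣P∣≡k) ∣Ni∣≤k)))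
        -- The alternation would place all neighbours of `i`, being in `C`, among the `k ∸ 1`
        -- entries of `P`, against the minimum degree.
        conclude (inj₂ back-to-P) = contradiction
          (ℕ.≤-trans (minDeg i) (length-⊆ (neighbours-unique i) N⊆P))
          (ℕ.<⇒≱ (ℕ.≤-reflexive 1+∣P∣≡k))
          where
          closed : ∀ {u v} → Next Z u v → u ∈ P ⊎ u ∈ J → v ∈ P ⊎ v ∈ J
          closed p (inj₁ u∈P) = let x , x∈ , q = P-next u∈P in
            inj₂ (subst (_∈ J) (next-functional Z (unique c) q p) x∈)
          closed p (inj₂ u∈J) = let s , q , s∈ = back-to-P u∈J in
            inj₁ (subst (_∈ P) (next-functional Z (unique c) q p) s∈)
          -- `k ≥ 2` leaves a vertex in `J` from which to follow the circuit around.
          start : ∃ (_∈ J)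
          start = nonempty J (ℕ.≤-pred (subst (2 ≤_) (trans (sym 1+∣P∣≡k) (cong suc ∣P∣≡∣J∣)) k≥2))
            where
            nonempty : ∀ L → 1 ≤ length L → ∃ (_∈ L)
            nonempty (x ∷ _) _ = x , here refl
          N⊆P : ∀ {v} → v ∈ neighbours i → v ∈ P
          N⊆P {v} v∈ with next-closed {P = λ v → v ∈ P ⊎ v ∈ J} Z closed
                     (all-but-i (J≢i (proj₂ start))) (inj₂ (proj₂ start)) (C⊆ (neighbours⊆C i∈ v∈))
          ... | inj₁ v∈P = v∈P
          ... | inj₂ v∈J = contradiction (J⊆I v∈J) (disjoint (neighbours⊆C i∈ v∈))

    -- A covering circuit or equal neighbourhoods

    Equineighbourly : Set
    Equineighbourly = ∃ λ i → i ∈ I × length (neighbours i) ≡ k ×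
      (∀ {j v} → j ∈ I → v ∈ neighbours i → Adj G j v) × (∀ {j v} → j ∈ I → Adj G j v → v ∈ neighbours i)

    CoveringCircuit : Set
    CoveringCircuit = ∃ λ Z → Circuit Z × (∀ v → v ∈ Z)

    -- After the exchange only `j` is missing from the circuit, so inserting `j` covers everything.
    -- If this fails for every `j`, each neighbourhood contains that of `i` and has at most `k`
    -- elements, so it equals that of `i`.
    stuck : ∀ {Z i} → Circuit Z → (∀ {v} → v ∈ C → v ∈ Z) → i ∈ I → i ∉ Z →
      length (neighbours i) ≤ k → Preceded Z i → Followed Z i → CoveringCircuit ⊎ Equineighbourly
    stuck {Z} {i} c C⊆ i∈ i∉ le prec foll with sequence I same
      where
      open Stuck c C⊆ i∈ i∉ le prec foll
      same : ∀ {j} → j ∈ I → CoveringCircuit ⊎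
        (length (neighbours j) ≤ k × (∀ {v} → v ∈ neighbours i → v ∈ neighbours j))
      same {j} j∈ with j ≟ i
      ... | yes refl = inj₂ (le , id)
      ... | no j≢i with insert circuit′ (∈Z′ ∘ C≢j) j∈ j∉Z′
        where open Exchange j∈ j≢i
      ...   | inj₂ (le′ , prec′ , foll′) = inj₂ (le′ , neighbours-⊆ (preceded′ prec′) (followed′ foll′))
        where open Exchange j∈ j≢i
      ...   | inj₁ (Z″ , c″ , Z′⊆ , j∈″) = inj₁ (Z″ , c″ , all)
        where
        open Exchange j∈ j≢i
        all : ∀ v → v ∈ Z″
        all v with v ≟ j
        ... | yes refl = j∈″ (here refl)
        ... | no v≢j   = Z′⊆ (∈Z′ v≢j)
    ... | inj₁ cov = inj₁ cov
    ... | inj₂ same = inj₂ (i , i∈ , ℕ.≤-antisym le (minDeg i) ,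
            (λ j∈ v∈ → ∈-neighbours⁻ (proj₂ (same j∈) v∈)) , converse)
      where
      converse : ∀ {j v} → j ∈ I → Adj G j v → v ∈ neighbours i
      converse {j} {v} j∈ e with v ∈? neighbours i
      ... | yes v∈ = v∈
      ... | no v∉ = contradiction
        (length-⊆ (Unique-∷ v∉ (neighbours-unique i))
          λ { (here refl) → ∈-neighbours⁺ e ; (there w∈) → proj₂ (same j∈) w∈ })
        (ℕ.<⇒≱ (s≤s (ℕ.≤-trans (proj₁ (same j∈)) (minDeg i))))

    -- An insertion never loses vertices, so a single pass over `I` suffices.
    insertAll : ∀ {Z} → Circuit Z → (∀ {v} → v ∈ C → v ∈ Z) → (todo : List V) →
      (∀ v → v ∈ Z ⊎ v ∈ todo) → (∀ {v} → v ∈ todo → v ∈ I) → CoveringCircuit ⊎ Equineighbourly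
    insertAll {Z} c C⊆ [] rest _ = inj₁ (Z , c , λ v → [ id , (λ ()) ]′ (rest v))
    insertAll {Z} c C⊆ (i ∷ todo) rest todo⊆ with i ∈? Z
    ... | yes i∈Z = insertAll c C⊆ todo rest′ (todo⊆ ∘ there)
      where
      rest′ : ∀ v → v ∈ Z ⊎ v ∈ todo
      rest′ v with rest v
      ... | inj₁ v∈Z = inj₁ v∈Z
      ... | inj₂ (here refl) = inj₁ i∈Z
      ... | inj₂ (there v∈) = inj₂ v∈
    ... | no i∉Z with insert c C⊆ (todo⊆ (here refl)) i∉Z
    ...   | inj₂ (le , prec , foll) = stuck c C⊆ (todo⊆ (here refl)) i∉Z le prec foll
    ...   | inj₁ (Z′ , c′ , Z⊆ , i∈′) = insertAll c′ (Z⊆ ∘ C⊆) todo rest′ (todo⊆ ∘ there)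
      where
      rest′ : ∀ v → v ∈ Z′ ⊎ v ∈ todo
      rest′ v with rest v
      ... | inj₁ v∈Z = inj₁ (Z⊆ v∈Z)
      ... | inj₂ (here refl) = inj₁ (i∈′ (here refl))
      ... | inj₂ (there v∈) = inj₂ v∈

    -- Recognising the exceptional graph

    Exceptional : Set
    Exceptional = n ≥ 2 * k + 1 × G ≅ (K k ∨ ((K k) ᶜ ∪ K (n ∸ 2 * k)))

    -- The common neighbourhood `N` becomes `K k`, the list `I` its edgeless counterpart, and the
    -- rest `R` of the clique becomes `K (n ∸ 2 * k)`. The bound on `n` comes from `∣C∣`.
    equineighbourly⇒exceptional : Equineighbourly → Exceptional
    equineighbourly⇒exceptional (i , i∈ , ∣N∣ , joined , confined) =
      bound , resize ∣N∣ ∣I∣ ∣R∣ (to↔ , λ x y → adjacency x y)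
      where
      N R : List V
      N = neighbours i
      R = others (N ++ I)
      N⊆C : ∀ {v} → v ∈ N → v ∈ C
      N⊆C = neighbours⊆C i∈
      uNI : Unique (N ++ I)
      uNI = Unique-++⁺ (neighbours-unique i) uI λ (p , q) → disjoint (N⊆C p) q
      ∣NI∣ : length (N ++ I) ≡ 2 * k
      ∣NI∣ = trans (length-++ N) (cong₂ _+_ ∣N∣ (trans ∣I∣ (sym (ℕ.+-identityʳ k))))
      ∣R∣ : length R ≡ n ∸ 2 * k
      ∣R∣ = begin
        length R                        ≡⟨ ℕ.m+n∸m≡n (2 * k) _ ⟨
        2 * k + length R ∸ 2 * k        ≡⟨ cong (λ m → m + length R ∸ 2 * k) ∣NI∣ ⟨
        length (N ++ I) + length R ∸ 2 * k ≡⟨ cong (_∸ 2 * k) (length-others uNI) ⟩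
        n ∸ 2 * k                       ∎
        where open ≡-Reasoning
      bound : n ≥ 2 * k + 1
      bound = begin
        2 * k + 1           ≡⟨ cong (_+ 1) (cong (k +_) (ℕ.+-identityʳ k)) ⟩
        k + k + 1           ≡⟨ trans (ℕ.+-assoc k k 1) (cong (k +_) (ℕ.+-comm k 1)) ⟩
        k + suc k           ≤⟨ ℕ.+-mono-≤ (ℕ.≤-reflexive (sym ∣I∣)) ∣C∣ ⟩
        length I + length C ≡⟨ length-++ I ⟨
        length (I ++ C)     ≤⟨ length≤n (Unique-++⁺ uI uC λ (p , q) → disjoint q p) ⟩
        n                   ∎
        where open ℕ.≤-Reasoning
      R⊆C : ∀ {v} → v ∈ R → v ∈ C
      R⊆C {v} v∈ with covered v
      ... | inj₁ v∈C = v∈C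
      ... | inj₂ v∈I = contradiction (∈-++⁺ʳ N v∈I) (∈-others⁻ v∈)

      H : Graph (Fin (length N) ⊎ (Fin (length I) ⊎ Fin (length R)))
      H = K (length N) ∨ ((K (length I)) ᶜ ∪ K (length R))

      -- With the lengths abstracted to variables, matching on `refl` moves the isomorphism to the
      -- required index sets.
      resize : ∀ {a b r} → a ≡ k → b ≡ k → r ≡ n ∸ 2 * k →
        G ≅ (K a ∨ ((K b) ᶜ ∪ K r)) → G ≅ (K k ∨ ((K k) ᶜ ∪ K (n ∸ 2 * k)))
      resize refl refl refl iso = iso

      class : ∀ v → v ∈ N ⊎ (v ∈ I ⊎ v ∈ R)
      class v with v ∈? N | v ∈? I
      ... | yes v∈N | _       = inj₁ v∈N
      ... | no _    | yes v∈I = inj₂ (inj₁ v∈I)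
      ... | no v∉N  | no v∉I  = inj₂ (inj₂ (∈-others⁺ ([ v∉N , v∉I ]′ ∘ ∈-++⁻ N)))

      position : ∀ {v} → v ∈ N ⊎ (v ∈ I ⊎ v ∈ R) → Fin (length N) ⊎ (Fin (length I) ⊎ Fin (length R))
      position (inj₁ p)        = inj₁ (Any.index p)
      position (inj₂ (inj₁ p)) = inj₂ (inj₁ (Any.index p))
      position (inj₂ (inj₂ p)) = inj₂ (inj₂ (Any.index p))

      at : Fin (length N) ⊎ (Fin (length I) ⊎ Fin (length R)) → V
      at (inj₁ a)        = lookup N a
      at (inj₂ (inj₁ a)) = lookup I a
      at (inj₂ (inj₂ a)) = lookup R a

      at-position : ∀ {v} (q : v ∈ N ⊎ (v ∈ I ⊎ v ∈ R)) → at (position q) ≡ v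
      at-position (inj₁ p)        = sym (lookup-index p)
      at-position (inj₂ (inj₁ p)) = sym (lookup-index p)
      at-position (inj₂ (inj₂ p)) = sym (lookup-index p)

      -- The three lists are disjoint and free of repetition, so the position is the same for every
      -- membership proof, in particular for the one chosen by `class`.
      position-at : ∀ {v} (q : v ∈ N ⊎ (v ∈ I ⊎ v ∈ R)) w → at w ≡ v → position q ≡ w
      position-at (inj₁ p) (inj₁ a) refl =
        cong inj₁ (lookup-injective (neighbours-unique i) _ _ (sym (lookup-index p)))
      position-at (inj₁ p) (inj₂ (inj₁ a)) refl = contradiction (∈-lookup a) (disjoint (N⊆C p))
      position-at (inj₁ p) (inj₂ (inj₂ a)) refl = contradiction (∈-++⁺ˡ p) (∈-others⁻ (∈-lookup a))
      position-at (inj₂ (inj₁ p)) (inj₁ a) refl = contradiction p (disjoint (N⊆C (∈-lookup a)))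
      position-at (inj₂ (inj₁ p)) (inj₂ (inj₁ a)) refl =
        cong (inj₂ ∘ inj₁) (lookup-injective uI _ _ (sym (lookup-index p)))
      position-at (inj₂ (inj₁ p)) (inj₂ (inj₂ a)) refl =
        contradiction (∈-++⁺ʳ N p) (∈-others⁻ (∈-lookup a))
      position-at (inj₂ (inj₂ p)) (inj₁ a) refl = contradiction (∈-++⁺ˡ (∈-lookup {xs = N} a)) (∈-others⁻ p)
      position-at (inj₂ (inj₂ p)) (inj₂ (inj₁ a)) refl =
        contradiction (∈-++⁺ʳ N (∈-lookup a)) (∈-others⁻ p)
      position-at (inj₂ (inj₂ p)) (inj₂ (inj₂ a)) refl =
        cong (inj₂ ∘ inj₂) (lookup-injective (others-unique (N ++ I)) _ _ (sym (lookup-index p)))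

      to↔ : V ↔ (Fin (length N) ⊎ (Fin (length I) ⊎ Fin (length R)))
      to↔ = mk↔ₛ′ (position ∘ class) at (λ w → position-at (class (at w)) w refl) (at-position ∘ class)

      sameIndex : ∀ {L x y} → Unique L → (p : x ∈ L) (q : y ∈ L) → x ≡ y → Any.index p ≡ Any.index q
      sameIndex u p q e = lookup-injective u _ _ (trans (sym (lookup-index p)) (trans e (lookup-index q)))

      cliqueAdj : ∀ {L x y} → Unique L → (∀ {v} → v ∈ L → v ∈ C) → (p : x ∈ L) (q : y ∈ L) →
        Adj G x y ⇔ (Any.index p ≢ Any.index q)
      cliqueAdj u L⊆ p q = mk⇔
        (λ e eq → adj-irrefl G (index-injective (setoid V) p q eq) e)
        (λ ne → clique (L⊆ p) (L⊆ q) (ne ∘ sameIndex u p q))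

      adjacency : ∀ x y → Adj G x y ⇔ Adj H (position (class x)) (position (class y))
      adjacency x y with class x | class y
      ... | inj₁ p        | inj₁ q        = cliqueAdj (neighbours-unique i) N⊆C p q
      ... | inj₁ p        | inj₂ (inj₁ q) = mk⇔ _ λ _ → adj-sym G (joined q p)
      ... | inj₁ p        | inj₂ (inj₂ q) = mk⇔ _ λ _ → clique (N⊆C p) (R⊆C q) λ { refl → ∈-others⁻ q (∈-++⁺ˡ p) }
      ... | inj₂ (inj₁ p) | inj₁ q        = mk⇔ _ λ _ → joined p q
      ... | inj₂ (inj₂ p) | inj₁ q        = mk⇔ _ λ _ → clique (R⊆C p) (N⊆C q) λ { refl → ∈-others⁻ p (∈-++⁺ˡ q) }
      -- An edge in the complement of a complete graph would join vertices both distinct and not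
      -- distinct.
      ... | inj₂ (inj₁ p) | inj₂ (inj₁ q) = mk⇔ (λ e → contradiction e (indep p q))
                                              λ { (Pointwise.inj₁ (ne , ¬ne)) → contradiction ne ¬ne }
      ... | inj₂ (inj₁ p) | inj₂ (inj₂ q) = mk⇔ (λ e → contradiction (∈-++⁺ˡ (confined p e)) (∈-others⁻ q)) λ ()
      ... | inj₂ (inj₂ p) | inj₂ (inj₁ q) = mk⇔ (λ e → contradiction (∈-++⁺ˡ (confined q (adj-sym G e))) (∈-others⁻ p)) λ ()
      ... | inj₂ (inj₂ p) | inj₂ (inj₂ q) = mk⇔ (Pointwise.inj₂ ∘ to′) λ { (Pointwise.inj₂ ne) → from′ ne }
        where open Equivalence (cliqueAdj (others-unique (N ++ I)) R⊆C p q) renaming (to to to′; from to from′)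

    Hamiltonian⊎exceptional : n ≥ 3 → Hamiltonian G ⊎ Exceptional
    Hamiltonian⊎exceptional n≥3 with insertAll clique-circuit id I covered id
    ... | inj₁ (Z , c , all) = inj₁ (covering⇒Hamiltonian n≥3 c all)
    ... | inj₂ e = inj₂ (equineighbourly⇒exceptional e)

-- From an independent set of k + 1 vertices to a split graph

theorem1 : (k n : ℕ) → k ≥ 2 → (G : Graph (Fin n)) → k -Connected G → χ G ≥ n ∸ k →
    Hamiltonian G ⊎ (n ≥ 2 * k + 1 × G ≅ (K k ∨ ((K k) ᶜ ∪ K (n ∸ 2 * k))))
theorem1 k n k≥2 G kc@(n>k , _) χ≥ with Connectivity.Hamiltonian⊎independent G k≥2 kc
... | inj₁ ham = inj₁ ham
... | inj₂ (I , ∣I∣ , uI , indep) with Colouring.dominating G χ≥ uI ∣I∣ indep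
...   | v , v∈ , dom with rotateTo v∈
-- The dominating vertex `v` changes sides: it joins the clique outside `I`, and the remaining `k`
-- vertices `J` form the independent part.
...     | J , perm , _ = SplitGraph.Hamiltonian⊎exceptional G k≥2 (minDegree kc) {C = v ∷ others I} {I = J}
            (Unique-∷ (λ p → ∈-others⁻ p v∈) (others-unique I)) (AllPairs.tail uvJ) ∣J∣ ∣C∣
            covered disjoint clique (λ p q → indep (J⊆I p) (J⊆I q)) (ℕ.≤-trans (s≤s k≥2) n>k)
  where
  open Circuits G
  open Connectivity G
  open Colouring G
  open DecPropositional (_≟_ {n}) using (_∈?_)
  uvJ : Unique (v ∷ J)
  uvJ = Unique-resp-↭ perm uI
  J⊆I : ∀ {x} → x ∈ J → x ∈ I
  J⊆I = ∈-resp-↭ (↭-sym perm) ∘ there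
  ∣J∣ : length J ≡ k
  ∣J∣ = ℕ.suc-injective (trans (sym (↭-length perm)) ∣I∣)
  neighbour∉I : ∀ {x w} → x ∈ I → Adj G x w → w ∉ I
  neighbour∉I x∈ e w∈ = indep x∈ w∈ e
  -- All neighbours of `v`, at least `k` of them, lie outside `I`; `v` itself makes the inequality
  -- strict.
  ∣C∣ : length (v ∷ others I) > k
  ∣C∣ = s≤s (ℕ.≤-trans (minDegree kc v) (length-⊆ (neighbours-unique v)
    λ w∈ → ∈-others⁺ (neighbour∉I v∈ (∈-neighbours⁻ w∈))))
  covered : ∀ x → x ∈ v ∷ others I ⊎ x ∈ J
  covered x with x ∈? I
  ... | no x∉ = inj₁ (there (∈-others⁺ x∉))
  ... | yes x∈ with ∈-resp-↭ perm x∈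
  ...   | here e    = inj₁ (here e)
  ...   | there x∈J = inj₂ x∈J
  disjoint : ∀ {x} → x ∈ v ∷ others I → x ∉ J
  disjoint (here refl) x∈J = Unique[x∷xs]⇒x∉xs uvJ x∈J
  disjoint (there x∈)  x∈J = ∈-others⁻ x∈ (J⊆I x∈J)
  clique : ∀ {x y} → x ∈ v ∷ others I → y ∈ v ∷ others I → x ≢ y → Adj G x y
  clique (here refl) (here refl) x≢y = contradiction refl x≢y
  clique (here refl) (there y∈)  _   = dom (∈-others⁻ y∈)
  clique (there x∈)  (here refl) _   = adj-sym G (dom (∈-others⁻ x∈))
  clique (there x∈)  (there y∈)  x≢y = outside-clique χ≥ uI ∣I∣ indep (∈-others⁻ x∈) (∈-others⁻ y∈) x≢y
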